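{- Let $G=(V,E)$ be a finite connected graph with $n$ vertices and edges $e_1,\dots,e_m$, each edge given an orientation, and let $h=m-n+1$. Let $\partial:\mathbb{R}^E\to\mathbb{R}^V$ be the boundary map $e\mapsto \partial^+(e)-\partial^-(e)$ (head minus tail), so that $H_1(G,\mathbb{Z})=\ker(\partial)\cap\mathbb{Z}^E$ is free of rank $h$. Fix a $\mathbb{Z}$-basis $\gamma_1,\dots,\gamma_h$ of $H_1(G,\mathbb{Z})$ and let $M$ be the $h\times m$ real matrix whose $i$-th row is the coordinate vector of $\gamma_i$ in the standard basis $e_1,\dots,e_m$ of $\mathbb{R}^E$. Let $\mathbf{p}\in\mathbb{R}^V$ be a nonzero vector whose coordinates sum to $0$, let $\omega\in\mathbb{R}^E$ with $\partial(\omega)=\mathbf{p}$, and let $N$ be the $(h+1)\times m$ matrix whose rows are the coordinate vectors of $\gamma_1,\dots,\gamma_h,\omega$. Let $U$ be a topological space, $y_1,\dots,y_m:U\to\mathbb{R}_{>0}$ continuous functions, and $Y=\mathrm{diag}(y_1,\dots,y_m)$. Let $A:U\to\mathrm{Mat}_{m\times m}(\mathbb{R})$ be a map such that (i) there is $C>0$ with all entries of $A(s)$ in $[-C,C]$ for all $s\in U$, and (ii) the matrices $M(Y+A)M^\tau$ and $N(Y+A)N^\tau$ are invertible at every point of $U$. Then $$\frac{\det(N(Y+A)N^\tau)}{\det(M(Y+A)M^\tau)}-\frac{\det(NYN^\tau)}{\det(MYM^\tau)}=O_{\underline y}(1).$$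
   Context: Notation: for real functions $F_1,F_2$ on $U$, $F_1=O_{\underline y}(F_2)$ means there exist constants $c,C'>0$ such that $|F_1(s)|\le c|F_2(s)|$ for all $s\in U$ with $y_1(s),\dots,y_m(s)\ge C'$. All matrices are evaluated pointwise at $s\in U$; $X^\tau$ denotes the transpose. -}

module Defs where

open import Algebra.Bundles using (CommutativeRing; Semiring)
open import Algebra.Core using (Op₁; Op₂)
open import Algebra.Structures using (IsCommutativeRing)
import Algebra.Definitions as AlgDefs
import Algebra.Definitions.RawMonoid as RawMonoidDefs
import Algebra.Definitions.RawSemiring as RawSemiringDefs
open import Data.Fin.Base using (Fin; zero; suc; toℕ; fromℕ)
open import Data.Fin.Properties using (_≟_)
open import Data.Integer.Base as ℤ using (ℤ; 0ℤ)
open import Data.Nat.Base as ℕ using (ℕ; zero; suc)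
open import Data.Product.Base using (∃; _×_; proj₁)
open import Data.Sum.Base using (_⊎_)
open import Data.Unit.Polymorphic.Base using (⊤)
open import Data.Vec.Functional using (Vector; insertAt; removeAt; transpose)
open import Function.Base using (_∘_)
open import Level using (Level) renaming (suc to lsuc; _⊔_ to _⊔ˡ_)
open import Relation.Binary.Construct.Closure.Equivalence using (EqClosure)
open import Relation.Binary.Core using (Rel)
open import Relation.Binary.Definitions using (Cotransitive)
open import Relation.Binary.Lattice.Definitions using (Supremum)
open import Relation.Binary.PropositionalEquality.Core using (_≡_; _≗_)
open import Relation.Binary.Structures using (IsStrictPartialOrder)
open import Relation.Nullary.Decidable.Core using (yes; no)
open import Relation.Nullary.Negation.Core using (¬_)
open import Relation.Unary using (Pred; _∈_; _∩_; _≐_; ⋃)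

-- Neither equality nor the order is assumed decidable, so that constructive
-- reals qualify as well as classical ones; this is why _≤_ is a negation,
-- x # y stands for "x ≠ y", and binary suprema (needed for the absolute value)
-- are part of the structure.
record OrderedField (ℓ : Level) : Set (lsuc ℓ) where
  infix  8 -_
  infixl 7 _*_ _/_⟨_⟩
  infixl 6 _+_ _⊔_
  infix  4 _≈_ _<_ _≤_ _#_
  field
    Carrier : Set ℓ
    _≈_ _<_ : Rel Carrier ℓ
    _+_ _*_ : Op₂ Carrier
    -_      : Op₁ Carrier
    0# 1#   : Carrier
    _⊔_     : Op₂ Carrier

  _≤_ : Rel Carrier ℓ
  x ≤ y = ¬ (y < x)

  _#_ : Rel Carrier ℓ
  x # y = x < y ⊎ y < x

  ∣_∣ : Op₁ Carrier
  ∣ x ∣ = x ⊔ (- x)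

  field
    isCommutativeRing    : IsCommutativeRing _≈_ _+_ _*_ -_ 0# 1#
    isStrictPartialOrder : IsStrictPartialOrder _≈_ _<_
    <-cotrans            : Cotransitive _<_
    ≤-antisym            : ∀ {x y} → x ≤ y → y ≤ x → x ≈ y
    ⊔-supremum           : Supremum _≤_ _⊔_
    0<1                  : 0# < 1#
    +-monoˡ-<            : ∀ {x y} z → x < y → x + z < y + z
    *-pos                : ∀ {x y} → 0# < x → 0# < y → 0# < x * y
    #0⇒invertible        : ∀ {x} → x # 0# → AlgDefs.Invertible _≈_ 1# _*_ x

  commutativeRing : CommutativeRing ℓ ℓ
  commutativeRing = record { isCommutativeRing = isCommutativeRing }

  open CommutativeRing commutativeRing public
    using (_-_; +-rawMonoid; semiring)

  -- k ⨯ x is the k-fold sum of x.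
  open RawMonoidDefs +-rawMonoid public using (sum) renaming (_×_ to _⨯_)
  open RawSemiringDefs (Semiring.rawSemiring semiring) public using (_^_)

  fromℤ : ℤ → Carrier
  fromℤ (ℤ.+ k)    = k ⨯ 1#
  fromℤ ℤ.-[1+ k ] = - (suc k ⨯ 1#)

  IsCauchy : (ℕ → Carrier) → Set ℓ
  IsCauchy a = ∀ ε → 0# < ε →
    ∃ λ N → ∀ i j → N ℕ.≤ i → N ℕ.≤ j → ∣ a i - a j ∣ < ε

  ConvergesTo : (ℕ → Carrier) → Carrier → Set ℓ
  ConvergesTo a l = ∀ ε → 0# < ε → ∃ λ N → ∀ i → N ℕ.≤ i → ∣ a i - l ∣ < ε

  _/_⟨_⟩ : ∀ x y → y # 0# → Carrier
  x / y ⟨ y#0 ⟩ = x * proj₁ (#0⇒invertible y#0)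

-- ℝ is given axiomatically: an Archimedean, Cauchy-complete ordered field is,
-- classically, unique up to isomorphism.
record RealNumbers (ℓ : Level) : Set (lsuc ℓ) where
  field
    orderedField : OrderedField ℓ

  open OrderedField orderedField public

  field
    archimedean : ∀ x → ∃ λ k → x < k ⨯ 1#
    complete    : ∀ a → IsCauchy a → ∃ (ConvergesTo a)

record Topology {ℓ} (X : Set ℓ) (o : Level) : Set (lsuc (ℓ ⊔ˡ o)) where
  field
    IsOpen      : Pred X ℓ → Set o
    open-resp-≐ : ∀ {P Q} → P ≐ Q → IsOpen P → IsOpen Q
    open-whole  : IsOpen (λ _ → ⊤)
    open-∩      : ∀ {P Q} → IsOpen P → IsOpen Q → IsOpen (P ∩ Q)
    -- The empty set is the case of an empty index type.
    open-⋃      : (I : Set ℓ) (F : I → Pred X ℓ) →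
                  (∀ i → IsOpen (F i)) → IsOpen (⋃ I F)

-- Edges are indexed, so that parallel edges and loops are allowed.
record OrientedGraph (n m : ℕ) : Set where
  field
    ∂⁺ : Fin m → Fin n
    ∂⁻ : Fin m → Fin n

  Arc : Rel (Fin n) _
  Arc u v = ∃ λ e → ∂⁻ e ≡ u × ∂⁺ e ≡ v

  IsConnected : Set
  IsConnected = Fin n × (∀ u v → EqClosure Arc u v)

  -- m - n + 1; in a connected graph n ≤ m + 1, so the subtraction is exact.
  -- (m ∸ n ℕ.+ 1 would be wrong for trees.)
  h : ℕ
  h = suc m ℕ.∸ n

module OverReals {ℓ} (R : RealNumbers ℓ) where
  open RealNumbers R

  Matrix : ℕ → ℕ → Set ℓ
  Matrix k l = Vector (Vector Carrier l) k

  infix  4 _≋_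
  infixl 6 _⊕_
  infixl 7 _·_
  infix  8 _ᵀ

  _≋_ : ∀ {k l} → Rel (Matrix k l) ℓ
  X ≋ Z = ∀ i j → X i j ≈ Z i j

  _⊕_ : ∀ {k l} → Op₂ (Matrix k l)
  (X ⊕ Z) i j = X i j + Z i j

  _·_ : ∀ {k l r} → Matrix k l → Matrix l r → Matrix k r
  (X · Z) i j = sum (λ t → X i t * Z t j)

  _ᵀ : ∀ {k l} → Matrix k l → Matrix l k
  X ᵀ = transpose X

  diag : ∀ {k} → Vector Carrier k → Matrix k k
  diag d i j with i ≟ j
  ... | yes _ = d i
  ... | no  _ = 0#

  𝟙 : ∀ {k} → Matrix k k
  𝟙 = diag (λ _ → 1#)

  Invertible : ∀ {k} → Pred (Matrix k k) ℓ
  Invertible = AlgDefs.Invertible _≋_ 𝟙 _·_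

  -- Laplace expansion along the first row.
  det : ∀ {k} → Matrix k k → Carrier
  det {zero}  X = 1#
  det {suc k} X =
    sum (λ j → (- 1#) ^ toℕ j * X zero j * det (λ r → removeAt (X (suc r)) j))

  IsOpenℝ : Pred Carrier ℓ → Set ℓ
  IsOpenℝ V = ∀ x → x ∈ V → ∃ λ ε → 0# < ε × (∀ z → ∣ z - x ∣ < ε → z ∈ V)

  module _ {U : Set ℓ} {o} (𝓣 : Topology U o) where
    open Topology 𝓣

    Continuous : (U → Carrier) → Set (lsuc ℓ ⊔ˡ o)
    Continuous f = ∀ V → IsOpenℝ V → IsOpen (V ∘ f)

  infix 4 _=O[_]_

  _=O[_]_ : ∀ {m} {U : Set ℓ} →
            (U → Carrier) → (Fin m → U → Carrier) → (U → Carrier) → Set ℓ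
  F₁ =O[ y ] F₂ = ∃ λ c → ∃ λ C′ → 0# < c × 0# < C′ ×
    (∀ s → (∀ e → C′ ≤ y e s) → ∣ F₁ s ∣ ≤ c * ∣ F₂ s ∣)

  module _ {n m : ℕ} (G : OrientedGraph n m) where
    open OrientedGraph G

    indicator : Fin n → Vector Carrier n
    indicator u v = 𝟙 u v

    ∂ : Vector Carrier m → Vector Carrier n
    ∂ x v = sum (λ e → x e * (indicator (∂⁺ e) v - indicator (∂⁻ e) v))

    -- H₁(G, ℤ) = ker ∂ ∩ ℤᴱ
    H₁ : Pred (Vector ℤ m) ℓ
    H₁ x = ∀ v → ∂ (fromℤ ∘ x) v ≈ 0#

    ℤ-combination : ∀ {k} → Vector ℤ k → Vector (Vector ℤ m) k → Vector ℤ m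
    ℤ-combination a γ e = RawMonoidDefs.sum ℤ.+-0-rawMonoid (λ i → a i ℤ.* γ i e)

    record IsℤBasis {k} (γ : Vector (Vector ℤ m) k) : Set ℓ where
      field
        members     : ∀ i → γ i ∈ H₁
        spanning    : ∀ x → x ∈ H₁ → ∃ λ a → x ≗ ℤ-combination a γ
        independent : ∀ a → (∀ e → ℤ-combination a γ e ≡ 0ℤ) → ∀ i → a i ≡ 0ℤ

  basisMatrix : ∀ {k m} → Vector (Vector ℤ m) k → Matrix k m
  basisMatrix γ i = fromℤ ∘ γ i

  appendRow : ∀ {k m} → Matrix k m → Vector Carrier m → Matrix (suc k) m
  appendRow {k} X ω = insertAt X (fromℕ k) ω

{-# OPTIONS --safe #-}
module Submission where

-- Write ⟨u, v⟩_B = u B vᵀ. If M B Mᵀ is invertible, there is a unique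
-- g_B ∈ ω + rowspan M with ⟨g_B, M i⟩_B = 0 for all i, and a row operation gives
-- det (N B Nᵀ) = det (M B Mᵀ) ⟨g_B, ω⟩_B. By orthogonality and the symmetry of Y,
-- the difference of the two quotients is exactly ⟨g_{Y+A}, g_Y⟩_A, so it suffices
-- to bound g_Y and g_{Y+A}. The vector g_Y is an electrical flow: it is the
-- gradient of a potential φ divided by y, so by cutting along a level set of φ the
-- flow through any edge is at most Σ ∣pᵥ∣, whatever y is. The difference
-- δ = g_{Y+A} - g_Y satisfies ⟨δ, δ⟩_Y = - ⟨g_{Y+A}, δ⟩_A, which bounds δ in terms
-- of g_Y as soon as y is large compared with the entries of A.

open import Defs
open import Algebra.Bundles using (CommutativeRing)
import Algebra.Definitions.RawMonoid as RawMonoidDefs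
import Algebra.Properties.Ring
import Algebra.Properties.Semiring.Mult
import Algebra.Properties.Semiring.Sum
import Algebra.Solver.Ring
open import Algebra.Solver.Ring.AlmostCommutativeRing using (fromCommutativeRing; _-Raw-AlmostCommutative⟶_)
open import Data.Fin.Base using (Fin; zero; suc; toℕ; fromℕ; inject₁; punchIn)
open import Data.Fin.Properties using (_≟_; suc-injective; toℕ-inject₁; fromℕ≢inject₁; sequence)
open import Data.Integer.Base as ℤ using (ℤ; +_; -[1+_]; 0ℤ; 1ℤ)
import Data.Integer.Properties as ℤ
open import Data.Maybe.Base using (Maybe; just; nothing)
open import Data.Nat.Base as ℕ using (ℕ; zero; suc)
open import Data.Product.Base using (Σ-syntax; ∃; _×_; _,_; proj₁; proj₂)
import Data.Sign.Base as Sign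
open import Data.Sum.Base using (_⊎_; inj₁; inj₂)
open import Data.Vec.Functional using (Vector; insertAt; removeAt; updateAt; _∷_; tail)
open import Data.Vec.Functional.Properties using (updateAt-updates; updateAt-minimal; insertAt-lookup; insertAt-punchIn)
open import Effect.Monad using (RawMonad)
open import Function.Base using (_∘_; const)
open import Relation.Binary.Construct.Closure.Equivalence using (EqClosure)
open import Relation.Binary.Construct.Closure.ReflexiveTransitive using (ε; _◅_)
open import Relation.Binary.Construct.Closure.Symmetric using (fwd; bwd)
open import Relation.Binary.PropositionalEquality.Core as ≡ using (_≡_; _≢_)
import Relation.Binary.Reasoning.Setoid
open import Relation.Binary.Structures using (IsStrictPartialOrder)
open import Relation.Nullary.Decidable.Core using (Dec; yes; no; ¬¬-excluded-middle)
open import Relation.Nullary.Negation using (¬¬-Monad)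
open import Relation.Nullary.Negation.Core using (¬_; contradiction)

-- The difficulty is uniformity: y is only bounded below, so the ratios of its entries are
-- unbounded, and comparing the Y-norm of g_Y with its Euclidean norm gives nothing. The cut
-- argument avoids this because it uses only the signs of the potential differences.
--
-- Neither the order nor equality can be tested, which shapes the rest. A determinant is shown apart
-- from zero through a product equal to one. For M Y Mᵀ the inverse has to be constructed: an
-- integral right inverse of M makes this matrix positive, and elimination on a positive matrix
-- meets only positive pivots. Case distinctions are free only under a negation, which covers every
-- goal of the form `_≤_`. Norms are kept squared and inequalities doubled, so that neither roots
-- nor halves occur.
--
-- Since `det` is an expansion along the first row, its multiplicativity is derived from the
-- uniqueness of alternating functions.

module Reals {ℓ} (R : RealNumbers ℓ) where

  open RealNumbers R public
  open CommutativeRing commutativeRing public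
    using ( refl; sym; trans; reflexive; setoid; ring; +-cong; +-congˡ; +-congʳ; *-cong; *-congˡ; *-congʳ
          ; -‿cong; +-identityˡ; +-identityʳ; +-assoc; +-comm; *-assoc; *-comm
          ; *-identityˡ; *-identityʳ; zeroˡ; zeroʳ; -‿inverseˡ; -‿inverseʳ; distribˡ; distribʳ )
  open Algebra.Properties.Ring ring public
    using (-0#≈0#; -1*x≈-x; -‿involutive; -‿distribˡ-*; -‿distribʳ-*; -‿+-comm)
  open Algebra.Properties.Semiring.Mult semiring public
    using (×-homo-+; ×1-homo-*)
  open Algebra.Properties.Semiring.Sum semiring public
    using (sum-cong-≋; sum-init-last; sum-replicate-zero; ∑-distrib-+; ∑-comm; *-distribˡ-sum; *-distribʳ-sum)
  module ≈-Reasoning = Relation.Binary.Reasoning.Setoid setoid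
  open IsStrictPartialOrder isStrictPartialOrder public
    using (<-resp-≈; irrefl) renaming (trans to <-trans)

  open ≈-Reasoning

  -- The ring homomorphism from the integers, and the ring solver.

  +-cancel-⊖ : ∀ a b c → (a + b) - (a + c) ≈ b - c
  +-cancel-⊖ a b c = begin
    (a + b) - (a + c)       ≈⟨ +-cong (+-comm a b) (sym (-‿+-comm a c)) ⟩
    (b + a) + (- a - c)     ≈⟨ +-assoc b a _ ⟩
    b + (a + (- a - c))     ≈⟨ +-congˡ (+-assoc a (- a) (- c)) ⟨
    b + ((a - a) - c)       ≈⟨ +-congˡ (+-congʳ (-‿inverseʳ a)) ⟩
    b + (0# - c)            ≈⟨ +-congˡ (+-identityˡ _) ⟩
    b - c                   ∎

  fromℤ-⊖ : ∀ m n → fromℤ (m ℤ.⊖ n) ≈ m ⨯ 1# - n ⨯ 1#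
  fromℤ-⊖ zero    zero    = sym (-‿inverseʳ 0#)
  fromℤ-⊖ zero    (suc n) = sym (+-identityˡ _)
  fromℤ-⊖ (suc m) zero    = sym (trans (+-congˡ -0#≈0#) (+-identityʳ _))
  fromℤ-⊖ (suc m) (suc n) = begin
    fromℤ (suc m ℤ.⊖ suc n)     ≡⟨ ≡.cong fromℤ (ℤ.[1+m]⊖[1+n]≡m⊖n m n) ⟩
    fromℤ (m ℤ.⊖ n)             ≈⟨ fromℤ-⊖ m n ⟩
    m ⨯ 1# - n ⨯ 1#             ≈⟨ +-cancel-⊖ 1# _ _ ⟨
    suc m ⨯ 1# - suc n ⨯ 1#     ∎

  fromℤ-+ : ∀ i j → fromℤ (i ℤ.+ j) ≈ fromℤ i + fromℤ j
  fromℤ-+ (+ m)    (+ n)    = ×-homo-+ 1# m n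
  fromℤ-+ (+ m)    -[1+ n ] = fromℤ-⊖ m (suc n)
  fromℤ-+ -[1+ m ] (+ n)    = trans (fromℤ-⊖ n (suc m)) (+-comm _ _)
  fromℤ-+ -[1+ m ] -[1+ n ] = begin
    - (suc (suc (m ℕ.+ n)) ⨯ 1#)      ≈⟨ -‿cong (+-assoc _ _ _) ⟨
    - (1# + 1# + (m ℕ.+ n) ⨯ 1#)      ≈⟨ -‿cong (+-congˡ (×-homo-+ 1# m n)) ⟩
    - (1# + 1# + (m ⨯ 1# + n ⨯ 1#))   ≈⟨ -‿cong (+-assoc _ _ _) ⟩
    - (1# + (1# + (m ⨯ 1# + n ⨯ 1#))) ≈⟨ -‿cong (+-congˡ (+-assoc _ _ _)) ⟨
    - (1# + (1# + m ⨯ 1# + n ⨯ 1#))   ≈⟨ -‿cong (+-congˡ (+-comm _ _)) ⟩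
    - (1# + (n ⨯ 1# + suc m ⨯ 1#))    ≈⟨ -‿cong (+-assoc _ _ _) ⟨
    - (suc n ⨯ 1# + suc m ⨯ 1#)       ≈⟨ -‿cong (+-comm _ _) ⟩
    - (suc m ⨯ 1# + suc n ⨯ 1#)       ≈⟨ -‿+-comm _ _ ⟨
    - (suc m ⨯ 1#) - suc n ⨯ 1#       ∎

  fromℤ-neg : ∀ i → fromℤ (ℤ.- i) ≈ - fromℤ i
  fromℤ-neg (+ zero)  = sym -0#≈0#
  fromℤ-neg (+ suc n) = refl
  fromℤ-neg -[1+ n ]  = sym (-‿involutive _)

  fromℤ-◃ : ∀ n → fromℤ (Sign.- ℤ.◃ n) ≈ - (n ⨯ 1#)
  fromℤ-◃ zero    = sym -0#≈0#
  fromℤ-◃ (suc n) = refl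

  fromℤ-* : ∀ i j → fromℤ (i ℤ.* j) ≈ fromℤ i * fromℤ j
  fromℤ-* (+ m)    (+ n)    =
    trans (reflexive (≡.cong fromℤ (ℤ.+◃n≡+n (m ℕ.* n)))) (×1-homo-* m n)
  fromℤ-* (+ m)    -[1+ n ] =
    trans (fromℤ-◃ (m ℕ.* suc n))
      (trans (-‿cong (×1-homo-* m (suc n))) (-‿distribʳ-* _ _))
  fromℤ-* -[1+ m ] (+ n)    =
    trans (fromℤ-◃ (suc m ℕ.* n))
      (trans (-‿cong (×1-homo-* (suc m) n)) (-‿distribˡ-* _ _))
  fromℤ-* -[1+ m ] -[1+ n ] = begin
    (suc m ℕ.* suc n) ⨯ 1#              ≈⟨ ×1-homo-* (suc m) (suc n) ⟩
    suc m ⨯ 1# * suc n ⨯ 1#             ≈⟨ -‿involutive _ ⟨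
    - - (suc m ⨯ 1# * suc n ⨯ 1#)       ≈⟨ -‿cong (-‿distribʳ-* _ _) ⟩
    - (suc m ⨯ 1# * - (suc n ⨯ 1#))     ≈⟨ -‿distribˡ-* _ _ ⟩
    - (suc m ⨯ 1#) * - (suc n ⨯ 1#)     ∎

  fromℤ-1 : fromℤ ℤ.1ℤ ≈ 1#
  fromℤ-1 = +-identityʳ 1#

  -- The solver has to recognise equal coefficients, which is possible for integers but not for
  -- reals; hence integer coefficients.
  ℤ⟶R : ℤ.+-*-rawRing -Raw-AlmostCommutative⟶ fromCommutativeRing commutativeRing
  ℤ⟶R = record
    { ⟦_⟧    = fromℤ
    ; +-homo = fromℤ-+
    ; *-homo = fromℤ-*
    ; -‿homo = fromℤ-neg
    ; 0-homo = refl
    ; 1-homo = fromℤ-1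
    }

  fromℤ-≟ : ∀ i j → Maybe (fromℤ i ≈ fromℤ j)
  fromℤ-≟ i j with i ℤ.≟ j
  ... | yes i≡j = just (reflexive (≡.cong fromℤ i≡j))
  ... | no  _   = nothing

  open Algebra.Solver.Ring _ _ ℤ⟶R fromℤ-≟ public
    using (Polynomial; solve; _:=_; _:+_; _:*_; _:-_; :-_; con)

  :0 : ∀ {n} → Polynomial n
  :0 = con ℤ.0ℤ

  -- Order, absolute value, apartness and finite sums.

  <-cong : ∀ {a b c d} → a ≈ c → b ≈ d → a < b → c < d
  <-cong a≈c b≈d = proj₁ <-resp-≈ b≈d ∘ proj₂ <-resp-≈ a≈c

  ≤-cong : ∀ {a b c d} → a ≈ c → b ≈ d → a ≤ b → c ≤ d
  ≤-cong a≈c b≈d a≤b d<c = a≤b (<-cong (sym b≈d) (sym a≈c) d<c)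

  <⇒≤ : ∀ {a b} → a < b → a ≤ b
  <⇒≤ a<b b<a = irrefl refl (<-trans a<b b<a)

  ≤-reflexive : ∀ {a b} → a ≈ b → a ≤ b
  ≤-reflexive a≈b = irrefl (sym a≈b)

  ≤-refl : ∀ {a} → a ≤ a
  ≤-refl = ≤-reflexive refl

  ≤-<-trans : ∀ {a b c} → a ≤ b → b < c → a < c
  ≤-<-trans {a} a≤b b<c with <-cotrans b<c a
  ... | inj₁ b<a = contradiction b<a a≤b
  ... | inj₂ a<c = a<c

  <-≤-trans : ∀ {a b c} → a < b → b ≤ c → a < c
  <-≤-trans {c = c} a<b b≤c with <-cotrans a<b c
  ... | inj₁ a<c = a<c
  ... | inj₂ c<b = contradiction c<b b≤c

  ≤-trans : ∀ {a b c} → a ≤ b → b ≤ c → a ≤ c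
  ≤-trans a≤b b≤c c<a = b≤c (<-≤-trans c<a a≤b)

  a<b⇒0<b-a : ∀ {a b} → a < b → 0# < b - a
  a<b⇒0<b-a {a} a<b = <-cong (-‿inverseʳ a) refl (+-monoˡ-< (- a) a<b)

  0<b-a⇒a<b : ∀ {a b} → 0# < b - a → a < b
  0<b-a⇒a<b {a} {b} p = <-cong (+-identityˡ a)
    (solve 2 (λ a b → b :- a :+ a := b) refl a b) (+-monoˡ-< a p)

  a≤b⇒0≤b-a : ∀ {a b} → a ≤ b → 0# ≤ b - a
  a≤b⇒0≤b-a {a} {b} a≤b b-a<0 = a≤b (<-cong
    (solve 2 (λ a b → b :- a :+ a := b) refl a b) (+-identityˡ a) (+-monoˡ-< a b-a<0))

  ≤-from-diff : ∀ {a b c} → 0# ≤ c → b ≈ a + c → a ≤ b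
  ≤-from-diff {a} {b} {c} 0≤c b≈a+c b<a = 0≤c (<-cong
    (trans (+-congʳ b≈a+c) (solve 2 (λ a c → a :+ c :- a := c) refl a c))
    (-‿inverseʳ a) (+-monoˡ-< (- a) b<a))

  <-from-diff : ∀ {a b c} → 0# < c → b ≈ a + c → a < b
  <-from-diff {a} {b} {c} 0<c b≈a+c = <-cong (+-identityˡ a)
    (trans (+-comm c a) (sym b≈a+c)) (+-monoˡ-< a 0<c)

  -‿anti-< : ∀ {a b} → a < b → - b < - a
  -‿anti-< {a} {b} a<b = <-from-diff (a<b⇒0<b-a a<b)
    (solve 2 (λ a b → :- a := :- b :+ (b :- a)) refl a b)

  +-monoˡ-≤ : ∀ {a b} c → a ≤ b → a + c ≤ b + c
  +-monoˡ-≤ {a} {b} c a≤b = ≤-from-diff (a≤b⇒0≤b-a a≤b)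
    (solve 3 (λ a b c → b :+ c := a :+ c :+ (b :- a)) refl a b c)

  +-mono-≤ : ∀ {a b c d} → a ≤ b → c ≤ d → a + c ≤ b + d
  +-mono-≤ {a} {b} {c} {d} a≤b c≤d = ≤-trans (+-monoˡ-≤ c a≤b)
    (≤-cong (+-comm c b) (+-comm d b) (+-monoˡ-≤ b c≤d))

  0≤+ : ∀ {a b} → 0# ≤ a → 0# ≤ b → 0# ≤ a + b
  0≤+ 0≤a 0≤b = ≤-cong (+-identityˡ 0#) refl (+-mono-≤ 0≤a 0≤b)

  0<+ : ∀ {a b} → 0# ≤ a → 0# < b → 0# < a + b
  0<+ {a} {b} 0≤a 0<b = ≤-<-trans 0≤a (<-from-diff 0<b refl)

  a<0⇒0<-a : ∀ {a} → a < 0# → 0# < - a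
  a<0⇒0<-a a<0 = <-cong refl (+-identityˡ _) (a<b⇒0<b-a a<0)

  -- The conclusion is a negation, so `¬¬-excluded-middle` permits cases on the positivity of each
  -- factor; a factor that is not positive is zero by antisymmetry.
  0≤* : ∀ {a b} → 0# ≤ a → 0# ≤ b → 0# ≤ a * b
  0≤* {a} {b} 0≤a 0≤b ab<0 = ¬¬-excluded-middle λ where
    (no a≯0)  → irrefl (trans (*-congʳ (≤-antisym a≯0 0≤a)) (zeroˡ b)) ab<0
    (yes 0<a) → ¬¬-excluded-middle λ where
      (no b≯0)  → irrefl (trans (*-congˡ (≤-antisym b≯0 0≤b)) (zeroʳ a)) ab<0
      (yes 0<b) → irrefl refl (<-trans ab<0 (*-pos 0<a 0<b))

  0≤ab⇒0≤b : ∀ {a b} → 0# < a → 0# ≤ a * b → 0# ≤ b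
  0≤ab⇒0≤b {a} {b} 0<a 0≤ab b<0 = irrefl refl (≤-<-trans 0≤ab
    (<-cong (solve 2 (λ a b → :- (a :* (:- b)) := a :* b) refl a b) -0#≈0#
      (-‿anti-< (*-pos 0<a (a<0⇒0<-a b<0)))))

  #0⇒0<² : ∀ {a} → a # 0# → 0# < a * a
  #0⇒0<² (inj₁ a<0) = <-cong refl (solve 1 (λ a → (:- a) :* (:- a) := a :* a) refl _)
    (*-pos (a<0⇒0<-a a<0) (a<0⇒0<-a a<0))
  #0⇒0<² (inj₂ 0<a) = *-pos 0<a 0<a

  0≤² : ∀ a → 0# ≤ a * a
  0≤² a a²<0 = ¬¬-excluded-middle λ where
    (yes a#0) → irrefl refl (<-trans a²<0 (#0⇒0<² a#0))
    (no ¬a#0) → irrefl (trans (*-congʳ (≤-antisym (¬a#0 ∘ inj₂) (¬a#0 ∘ inj₁))) (zeroˡ a)) a²<0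

  ≤∣∣ : ∀ a → a ≤ ∣ a ∣
  ≤∣∣ a = proj₁ (⊔-supremum a (- a))

  -≤∣∣ : ∀ a → - a ≤ ∣ a ∣
  -≤∣∣ a = proj₁ (proj₂ (⊔-supremum a (- a)))

  ∣∣≤ : ∀ {a b} → a ≤ b → - a ≤ b → ∣ a ∣ ≤ b
  ∣∣≤ {a} = proj₂ (proj₂ (⊔-supremum a (- a))) _

  0≤∣∣ : ∀ a → 0# ≤ ∣ a ∣
  0≤∣∣ a ∣a∣<0 = irrefl refl (<-trans (a<0⇒0<-a (≤-<-trans (≤∣∣ a) ∣a∣<0)) (≤-<-trans (-≤∣∣ a) ∣a∣<0))

  -- Comparing `x` with 0 < (k + 1) x by cotransitivity yields either the claim or x < (k + 1) x,
  -- that is 0 < k x, which is the case of a smaller multiple.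
  0<k*x⇒0<x : ∀ k {x} → 0# < (k ⨯ 1#) * x → 0# < x
  0<k*x⇒0<x zero    p = contradiction (<-cong refl (zeroˡ _) p) (irrefl refl)
  0<k*x⇒0<x (suc k) {x} p with <-cotrans p x
  ... | inj₁ 0<x = 0<x
  ... | inj₂ q   = 0<k*x⇒0<x k (<-cong refl
    -- `1#` is passed to the solver as a variable because `con 1ℤ` evaluates to `1# + 0#`. The same
    -- device recurs below.
    (solve 3 (λ o k x → (o :+ k) :* x :- o :* x := k :* x) refl 1# (k ⨯ 1#) x)
    (a<b⇒0<b-a (<-cong (sym (*-identityˡ x)) refl q)))

  -- That the inverse of a positive element is positive is not an axiom. It
  -- holds for natural numbers, one of which exceeds ∣ y ∣.
  xy≈1⇒x#0 : ∀ {x y} → x * y ≈ 1# → x # 0#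
  xy≈1⇒x#0 {x} {y} xy≈1 with archimedean ∣ y ∣
  ... | k , ∣y∣<k with #0⇒invertible (inj₂ (≤-<-trans (0≤∣∣ y) ∣y∣<k))
  ... | q , _ , kq≈1 with 0<k*x⇒0<x k (<-cong refl (sym kq≈1) 0<1)
  ... | 0<q with <-cotrans 0<q x
  ... | inj₁ 0<x = inj₂ 0<x
  ... | inj₂ x<q with <-cotrans 0<q (- x)
  ... | inj₁ 0<-x = inj₁ (<-cong (-‿involutive x) -0#≈0# (-‿anti-< 0<-x))
  -- Here both x and -x are below q = 1/b, while both y and -y are below b. So (q - x)(b + y) and (q
  -- + x)(b - y) are positive, yet they add up to 2(bq - xy) = 0.
  ... | inj₂ -x<q = contradiction
    (0<+ (<⇒≤ (*-pos (a<b⇒0<b-a x<q) (a<b⇒0<b-a (≤-<-trans (-≤∣∣ y) ∣y∣<k))))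
         (*-pos (a<b⇒0<b-a -x<q) (a<b⇒0<b-a (≤-<-trans (≤∣∣ y) ∣y∣<k))))
    (irrefl (sym (begin
      (q - x) * (b - - y) + (q - - x) * (b - y)
        ≈⟨ solve 4 (λ q x y b → (q :- x) :* (b :- :- y) :+ (q :- :- x) :* (b :- y)
             := (b :* q :- x :* y) :+ (b :* q :- x :* y)) refl q x y b ⟩
      (b * q - x * y) + (b * q - x * y)
        ≈⟨ +-cong bq-xy≈0 bq-xy≈0 ⟩
      0# + 0#
        ≈⟨ +-identityʳ 0# ⟩
      0# ∎)))
    where
    b : Carrier
    b = k ⨯ 1#
    bq-xy≈0 : b * q - x * y ≈ 0#
    bq-xy≈0 = trans (+-cong kq≈1 (-‿cong xy≈1)) (-‿inverseʳ 1#)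

  xy#0⇒x#0 : ∀ {x y} → x * y # 0# → x # 0#
  xy#0⇒x#0 xy#0 = let z , _ , xyz≈1 = #0⇒invertible xy#0 in xy≈1⇒x#0 (trans (sym (*-assoc _ _ _)) xyz≈1)

  -- Cotransitivity decides whether the head or the rest of the sum is apart from zero, so an index
  -- is actually found.
  sum-#0 : ∀ {k} (f : Vector Carrier k) → sum f # 0# → ∃ λ i → f i # 0#
  sum-#0 {zero}  f (inj₁ p) = contradiction p (irrefl refl)
  sum-#0 {zero}  f (inj₂ p) = contradiction p (irrefl refl)
  sum-#0 {suc k} f s#0 with head#0-or-tail#0 s#0
    where
    head#0-or-tail#0 : ∀ {a b} → a + b # 0# → a # 0# ⊎ b # 0#
    head#0-or-tail#0 {a} {b} (inj₁ p) with <-cotrans p a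
    ... | inj₂ q = inj₁ (inj₁ q)
    ... | inj₁ q = inj₂ (inj₁ (<-cong (solve 2 (λ a b → a :+ b :- a := b) refl a b)
                     (-‿inverseʳ a) (+-monoˡ-< (- a) q)))
    head#0-or-tail#0 {a} {b} (inj₂ p) with <-cotrans p a
    ... | inj₁ q = inj₁ (inj₂ q)
    ... | inj₂ q = inj₂ (inj₂ (<-cong (-‿inverseʳ a)
                     (solve 2 (λ a b → a :+ b :- a := b) refl a b) (+-monoˡ-< (- a) q)))
  ... | inj₁ h = zero , h
  ... | inj₂ t = let i , r = sum-#0 (f ∘ suc) t in suc i , r

  sum-mono-≤ : ∀ {k} {f g : Vector Carrier k} → (∀ i → f i ≤ g i) → sum f ≤ sum g
  sum-mono-≤ {zero}  f≤g = ≤-refl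
  sum-mono-≤ {suc k} f≤g = +-mono-≤ (f≤g zero) (sum-mono-≤ (f≤g ∘ suc))

  0≤sum : ∀ {k} {f : Vector Carrier k} → (∀ i → 0# ≤ f i) → 0# ≤ sum f
  0≤sum {k} 0≤f = ≤-cong (sum-replicate-zero k) refl (sum-mono-≤ 0≤f)

  term≤sum : ∀ {k} {f : Vector Carrier k} → (∀ i → 0# ≤ f i) → ∀ i → f i ≤ sum f
  term≤sum {suc k} {f} 0≤f zero    = ≤-from-diff (0≤sum (0≤f ∘ suc)) refl
  term≤sum {suc k} {f} 0≤f (suc i) = ≤-trans (term≤sum (0≤f ∘ suc) i) (≤-from-diff (0≤f zero) (+-comm _ _))

-- Multilinear and alternating functions of the rows of a matrix.

module Determinant {ℓ} (R : RealNumbers ℓ) where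

  open Reals R
  open OverReals R
  open ≈-Reasoning

  infix  4 _≋ᵥ_
  infixl 7 _⋆_
  infixl 8 _[_]≔_

  _≋ᵥ_ : ∀ {k} → Vector Carrier k → Vector Carrier k → Set ℓ
  u ≋ᵥ v = ∀ i → u i ≈ v i

  _⋆_ : ∀ {k l} → Vector Carrier k → Matrix k l → Vector Carrier l
  (x ⋆ X) j = sum (λ i → x i * X i j)

  _[_]≔_ : ∀ {k l} → Matrix k l → Fin k → Vector Carrier l → Matrix k l
  X [ i ]≔ v = updateAt X i (const v)

  sum-zero : ∀ {k} {f : Vector Carrier k} → (∀ i → f i ≈ 0#) → sum f ≈ 0#
  sum-zero {k} f≈0 = trans (sum-cong-≋ f≈0) (sum-replicate-zero k)

  sum-single : ∀ {k} (f : Vector Carrier k) i → (∀ j → j ≢ i → f j ≈ 0#) → sum f ≈ f i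
  sum-single {suc k} f zero    z = trans (+-congˡ (sum-zero (λ j → z (suc j) λ ()))) (+-identityʳ _)
  sum-single {suc k} f (suc i) z = trans
    (+-cong (z zero λ ()) (sum-single (f ∘ suc) i (λ j j≢i → z (suc j) (j≢i ∘ suc-injective))))
    (+-identityˡ _)

  𝟙-refl : ∀ {k} (i : Fin k) → 𝟙 i i ≈ 1#
  𝟙-refl i with i ≟ i
  ... | yes _   = refl
  ... | no  i≢i = contradiction ≡.refl i≢i

  𝟙-≢ : ∀ {k} {i j : Fin k} → i ≢ j → 𝟙 i j ≈ 0#
  𝟙-≢ {i = i} {j} i≢j with i ≟ j
  ... | yes i≡j = contradiction i≡j i≢j
  ... | no  _   = refl

  𝟙-suc : ∀ {k} (i j : Fin k) → 𝟙 (suc i) (suc j) ≈ 𝟙 i j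
  𝟙-suc i j with i ≟ j
  ... | yes _ = refl
  ... | no  _ = refl

  ⋆-𝟙 : ∀ {k} (x : Vector Carrier k) → x ⋆ 𝟙 ≋ᵥ x
  ⋆-𝟙 x j = begin
    sum (λ i → x i * 𝟙 i j) ≈⟨ sum-single _ j (λ i i≢j → trans (*-congˡ (𝟙-≢ i≢j)) (zeroʳ _)) ⟩
    x j * 𝟙 j j             ≈⟨ *-congˡ (𝟙-refl j) ⟩
    x j * 1#                ≈⟨ *-identityʳ _ ⟩
    x j                     ∎

  𝟙-⋆ : ∀ {k l} (i : Fin k) (X : Matrix k l) → 𝟙 i ⋆ X ≋ᵥ X i
  𝟙-⋆ i X c = begin
    sum (λ j → 𝟙 i j * X j c) ≈⟨ sum-single _ i (λ j j≢i → trans (*-congʳ (𝟙-≢ (j≢i ∘ ≡.sym))) (zeroˡ _)) ⟩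
    𝟙 i i * X i c             ≈⟨ *-congʳ (𝟙-refl i) ⟩
    1# * X i c                ≈⟨ *-identityˡ _ ⟩
    X i c                     ∎

  ⋆-congˡ : ∀ {k l} {x x′ : Vector Carrier k} (X : Matrix k l) → x ≋ᵥ x′ → x ⋆ X ≋ᵥ x′ ⋆ X
  ⋆-congˡ X x≋x′ j = sum-cong-≋ (λ i → *-congʳ (x≋x′ i))

  ⋆-linear : ∀ {k l} a (x x′ : Vector Carrier k) (X : Matrix k l) j →
             ((λ i → a * x i + x′ i) ⋆ X) j ≈ a * (x ⋆ X) j + (x′ ⋆ X) j
  ⋆-linear a x x′ X j = begin
    sum (λ i → (a * x i + x′ i) * X i j)
      ≈⟨ sum-cong-≋ (λ i → trans (distribʳ (X i j) (a * x i) (x′ i)) (+-congʳ (*-assoc a (x i) (X i j)))) ⟩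
    sum (λ i → a * (x i * X i j) + x′ i * X i j)
      ≈⟨ ∑-distrib-+ (λ i → a * (x i * X i j)) _ ⟩
    sum (λ i → a * (x i * X i j)) + (x′ ⋆ X) j
      ≈⟨ +-congʳ (*-distribˡ-sum a (λ i → x i * X i j)) ⟨
    a * (x ⋆ X) j + (x′ ⋆ X) j ∎

  ⋆-assoc : ∀ {k l r} (x : Vector Carrier k) (X : Matrix k l) (Z : Matrix l r) →
            x ⋆ X ⋆ Z ≋ᵥ x ⋆ (X · Z)
  ⋆-assoc x X Z c = begin
    sum (λ j → (x ⋆ X) j * Z j c)
      ≈⟨ sum-cong-≋ (λ j → *-distribʳ-sum (Z j c) (λ i → x i * X i j)) ⟩
    sum (λ j → sum (λ i → x i * X i j * Z j c))
      ≈⟨ ∑-comm (λ j i → x i * X i j * Z j c) ⟩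
    sum (λ i → sum (λ j → x i * X i j * Z j c))
      ≈⟨ sum-cong-≋ (λ i → sum-cong-≋ (λ j → *-assoc (x i) (X i j) (Z j c))) ⟩
    sum (λ i → sum (λ j → x i * (X i j * Z j c)))
      ≈⟨ sum-cong-≋ (λ i → *-distribˡ-sum (x i) (λ j → X i j * Z j c)) ⟨
    sum (λ i → x i * (X · Z) i c) ∎

  -- One axiom for `a * u + v` covers additivity and homogeneity. It is stated for three matrices
  -- that agree off row `i`, so that it applies equally to rows built by `_∷_`, `_[_]≔_` and
  -- `insertAt`. Matrices may be rectangular because the inductions fix a row or insert a column.
  record IsMultilinear {k l} (f : Matrix k l → Carrier) : Set ℓ where
    field
      cong   : ∀ {X Z} → X ≋ Z → f X ≈ f Z
      linear : ∀ i a {X Y Z} → (∀ r → r ≢ i → X r ≋ᵥ Z r) → (∀ r → r ≢ i → Y r ≋ᵥ Z r) →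
               (∀ c → Z i c ≈ a * X i c + Y i c) → f Z ≈ a * f X + f Y

    zero-row : ∀ {Z} i → (∀ c → Z i c ≈ 0#) → f Z ≈ 0#
    zero-row {Z} i z = begin
      f Z                ≈⟨ linear i (- 1#) {Z} {Z} {Z} (λ _ _ _ → refl) (λ _ _ _ → refl) row ⟩
      - 1# * f Z + f Z   ≈⟨ +-congʳ (-1*x≈-x _) ⟩
      - f Z + f Z        ≈⟨ -‿inverseˡ _ ⟩
      0#                 ∎
      where
      row : ∀ c → Z i c ≈ - 1# * Z i c + Z i c
      row c = trans (z c) (sym (trans (+-cong (*-congˡ (z c)) (z c))
                                (trans (+-identityʳ _) (zeroʳ _))))

  record IsAlternating {k l} (f : Matrix k l → Carrier) : Set ℓ where
    field
      isMultilinear : IsMultilinear f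
      vanish        : ∀ {X} i j → i ≢ j → X i ≋ᵥ X j → f X ≈ 0#
    open IsMultilinear isMultilinear public

  module _ {k l} (X : Matrix k l) where

    ≔-updates : ∀ i v c → (X [ i ]≔ v) i c ≈ v c
    ≔-updates i v c = reflexive (≡.cong (λ r → r c) (updateAt-updates i X))

    ≔-minimal : ∀ i v r → r ≢ i → (X [ i ]≔ v) r ≋ᵥ X r
    ≔-minimal i v r r≢i c = reflexive (≡.cong (λ r → r c) (updateAt-minimal r i X r≢i))

    ≔-agree : ∀ i u v r → r ≢ i → (X [ i ]≔ u) r ≋ᵥ (X [ i ]≔ v) r
    ≔-agree i u v r r≢i c = trans (≔-minimal i u r r≢i c) (sym (≔-minimal i v r r≢i c))

    ≔-id : ∀ i {v} → v ≋ᵥ X i → X [ i ]≔ v ≋ X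
    ≔-id i {v} v≋Xᵢ r c with r ≟ i
    ... | yes ≡.refl = trans (≔-updates i v c) (v≋Xᵢ c)
    ... | no  r≢i    = ≔-minimal i v r r≢i c

  module Multilinear {k l} {f : Matrix k l → Carrier} (f-lin : IsMultilinear f) where
    open IsMultilinear f-lin

    ≔-linear : ∀ X i a u v → f (X [ i ]≔ (λ c → a * u c + v c)) ≈ a * f (X [ i ]≔ u) + f (X [ i ]≔ v)
    ≔-linear X i a u v = linear i a (≔-agree X i u _) (≔-agree X i v _) λ c →
      trans (≔-updates X i _ c)
        (sym (+-cong (*-congˡ (≔-updates X i u c)) (≔-updates X i v c)))

    ≔-⋆ : ∀ X i {p} (a : Vector Carrier p) V → f (X [ i ]≔ (a ⋆ V)) ≈ sum (λ j → a j * f (X [ i ]≔ V j))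
    ≔-⋆ X i {zero}  a V = zero-row i (≔-updates X i _)
    ≔-⋆ X i {suc p} a V = trans (≔-linear X i (a zero) (V zero) (tail a ⋆ tail V))
                                (+-congˡ (≔-⋆ X i (tail a) (tail V)))

  module Alternating {k l} {f : Matrix k l → Carrier} (f-alt : IsAlternating f) where
    open IsAlternating f-alt
    open Multilinear isMultilinear public

    row-operation : ∀ X i (b : Vector Carrier k) → f (X [ i ]≔ (b ⋆ X)) ≈ b i * f X
    row-operation X i b = begin
      f (X [ i ]≔ (b ⋆ X))               ≈⟨ ≔-⋆ X i b X ⟩
      sum (λ j → b j * f (X [ i ]≔ X j)) ≈⟨ sum-single _ i (λ j j≢i → trans (*-congˡ (repeated j j≢i)) (zeroʳ _)) ⟩
      b i * f (X [ i ]≔ X i)             ≈⟨ *-congˡ (cong (≔-id X i (λ _ → refl))) ⟩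
      b i * f X                          ∎
      where
      repeated : ∀ j → j ≢ i → f (X [ i ]≔ X j) ≈ 0#
      repeated j j≢i = vanish i j (j≢i ∘ ≡.sym) λ c →
        trans (≔-updates X i (X j) c) (sym (≔-minimal X i (X j) j j≢i c))

    -- Polarisation: putting u + v into both rows gives zero, and of its four terms the two with
    -- equal rows vanish.
    swap : ∀ {X Z} i j → i ≢ j → Z i ≋ᵥ X j → Z j ≋ᵥ X i →
           (∀ r → r ≢ i → r ≢ j → Z r ≋ᵥ X r) → f Z ≈ - f X
    swap {X} {Z} i j i≢j Zᵢ Zⱼ Zᵣ = begin
      f Z                ≈⟨ cong Z≋ ⟩
      F v u              ≈⟨ +-identityʳ _ ⟨
      F v u + 0#         ≈⟨ +-congˡ (-‿inverseʳ _) ⟨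
      F v u + (F u v - F u v) ≈⟨ +-assoc _ _ _ ⟨
      F v u + F u v - F u v ≈⟨ +-cong (trans (+-comm _ _) sum≈0) (-‿cong (cong X≋)) ⟩
      0# - f X           ≈⟨ +-identityˡ _ ⟩
      - f X              ∎
      where
      u v : Vector Carrier l
      u = X i
      v = X j
      _+1_ : Vector Carrier l → Vector Carrier l → Vector Carrier l
      (x +1 y) c = 1# * x c + y c
      F : Vector Carrier l → Vector Carrier l → Carrier
      F x y = f (X [ i ]≔ x [ j ]≔ y)
      atᵢ : ∀ x y → (X [ i ]≔ x [ j ]≔ y) i ≋ᵥ x
      atᵢ x y c = trans (≔-minimal (X [ i ]≔ x) j y i i≢j c) (≔-updates X i x c)
      F-linʳ : ∀ x y z → F x (y +1 z) ≈ F x y + F x z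
      F-linʳ x y z = trans (≔-linear (X [ i ]≔ x) j 1# y z) (+-congʳ (*-identityˡ _))
      F-linˡ : ∀ x y z → F (x +1 y) z ≈ F x z + F y z
      F-linˡ x y z = trans
        (linear i 1# (agree x) (agree y)
          (λ c → trans (atᵢ (x +1 y) z c) (sym (+-cong (*-congˡ (atᵢ x z c)) (atᵢ y z c)))))
        (+-congʳ (*-identityˡ _))
        where
        agree : ∀ x r → r ≢ i → (X [ i ]≔ x [ j ]≔ z) r ≋ᵥ (X [ i ]≔ _ [ j ]≔ z) r
        agree x r r≢i c with r ≟ j
        ... | yes ≡.refl = trans (≔-updates _ j z c) (sym (≔-updates _ j z c))
        ... | no  r≢j    = trans (≔-minimal _ j z r r≢j c)
                             (trans (≔-agree X i x _ r r≢i c) (sym (≔-minimal _ j z r r≢j c)))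
      F-diag : ∀ x → F x x ≈ 0#
      F-diag x = vanish i j i≢j λ c → trans (atᵢ x x c) (sym (≔-updates _ j x c))
      sum≈0 : F u v + F v u ≈ 0#
      sum≈0 = begin
        F u v + F v u                       ≈⟨ +-cong (+-identityˡ _) (+-identityʳ _) ⟨
        (0# + F u v) + (F v u + 0#)         ≈⟨ +-cong (+-congʳ (F-diag u)) (+-congˡ (F-diag v)) ⟨
        (F u u + F u v) + (F v u + F v v)   ≈⟨ +-cong (F-linʳ u u v) (F-linʳ v u v) ⟨
        F u (u +1 v) + F v (u +1 v)         ≈⟨ F-linˡ u v (u +1 v) ⟨
        F (u +1 v) (u +1 v)                 ≈⟨ F-diag (u +1 v) ⟩
        0#                                  ∎
      X≋ : X [ i ]≔ u [ j ]≔ v ≋ X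
      X≋ r c with r ≟ j
      ... | yes ≡.refl = ≔-updates _ j v c
      ... | no  r≢j    = trans (≔-minimal _ j v r r≢j c) (≔-id X i (λ _ → refl) r c)
      Z≋ : Z ≋ X [ i ]≔ v [ j ]≔ u
      Z≋ r c with r ≟ j | r ≟ i
      ... | yes ≡.refl | _          = trans (Zⱼ c) (sym (≔-updates _ j u c))
      ... | no  r≢j    | yes ≡.refl = trans (Zᵢ c) (sym (atᵢ v u c))
      ... | no  r≢j    | no  r≢i    = trans (Zᵣ r r≢i r≢j c)
        (sym (trans (≔-minimal _ j u r r≢j c) (≔-minimal X i v r r≢i c)))


  cons-multilinear : ∀ {k l} {f : Matrix (suc k) l → Carrier} → IsMultilinear f →
                     ∀ u → IsMultilinear (λ T → f (u ∷ T))
  cons-multilinear f-lin u = record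
    { cong   = λ X≋Z → cong λ { zero c → refl ; (suc r) c → X≋Z r c }
    ; linear = λ i a X≋Z Y≋Z Zᵢ → linear (suc i) a
        (λ { zero _ _ → refl ; (suc r) r≢i → X≋Z r (r≢i ∘ ≡.cong suc) })
        (λ { zero _ _ → refl ; (suc r) r≢i → Y≋Z r (r≢i ∘ ≡.cong suc) })
        Zᵢ
    }
    where open IsMultilinear f-lin

  cons-alternating : ∀ {k l} {f : Matrix (suc k) l → Carrier} → IsAlternating f →
                     ∀ u → IsAlternating (λ T → f (u ∷ T))
  cons-alternating f-alt u = record
    { isMultilinear = cons-multilinear isMultilinear u
    ; vanish        = λ i j i≢j → vanish (suc i) (suc j) (i≢j ∘ suc-injective)
    }
    where open IsAlternating f-alt

  clear-rows : ∀ {k l} {g : Matrix k l → Carrier} → IsMultilinear g → ∀ u →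
               (∀ {T} r → T r ≋ᵥ u → g T ≈ 0#) →
               ∀ (a : Vector Carrier k) {T T°} → (∀ r c → T r c ≈ a r * u c + T° r c) → g T ≈ g T°
  clear-rows {zero}  g-lin u g-vanish a T≋ = IsMultilinear.cong g-lin λ ()
  clear-rows {suc k} {g = g} g-lin u g-vanish a {T} {T°} T≋ = begin
    g T
      ≈⟨ linear zero (a zero) {u ∷ tail T} {T° zero ∷ tail T}
           (λ { zero 0≢0 → contradiction ≡.refl 0≢0 ; (suc r) _ c → refl })
           (λ { zero 0≢0 → contradiction ≡.refl 0≢0 ; (suc r) _ c → refl }) (T≋ zero) ⟩
    a zero * g (u ∷ tail T) + g (T° zero ∷ tail T)
      ≈⟨ +-congʳ (trans (*-congˡ (g-vanish zero λ c → refl)) (zeroʳ _)) ⟩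
    0# + g (T° zero ∷ tail T)
      ≈⟨ +-identityˡ _ ⟩
    g (T° zero ∷ tail T)
      ≈⟨ clear-rows (cons-multilinear g-lin (T° zero)) u (λ r → g-vanish (suc r)) (tail a) (T≋ ∘ suc) ⟩
    g (T° zero ∷ tail T°)
      ≈⟨ cong (λ { zero c → refl ; (suc r) c → refl }) ⟩
    g T° ∎
    where open IsMultilinear g-lin

  -- Row `i` rises to the top by `toℕ i` adjacent swaps, each contributing one sign.
  move-row : ∀ {k l} {f : Matrix (suc k) l → Carrier} → IsAlternating f → ∀ X i →
             f (X i ∷ removeAt X i) ≈ (- 1#) ^ toℕ i * f X
  move-row f-alt X zero = trans (cong λ { zero c → refl ; (suc r) c → refl }) (sym (*-identityˡ _))
    where open IsAlternating f-alt
  move-row {suc k} {f = f} f-alt X (suc i) = begin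
    f (X (suc i) ∷ removeAt X (suc i))
      ≈⟨ Alternating.swap f-alt {X zero ∷ (X (suc i) ∷ removeAt (tail X) i)} zero (suc zero) (λ ()) (λ c → refl) (λ c → refl)
           (λ { zero 0≢0 _ → contradiction ≡.refl 0≢0 ; (suc zero) _ 1≢1 → contradiction ≡.refl 1≢1 ; (suc (suc r)) _ _ c → refl }) ⟩
    - f (X zero ∷ (X (suc i) ∷ removeAt (tail X) i))
      ≈⟨ -‿cong (move-row (cons-alternating f-alt (X zero)) (tail X) i) ⟩
    - ((- 1#) ^ toℕ i * f (X zero ∷ tail X))
      ≈⟨ -‿cong (*-congˡ (cong λ { zero c → refl ; (suc r) c → refl })) ⟩
    - ((- 1#) ^ toℕ i * f X)
      ≈⟨ -1*x≈-x _ ⟨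
    - 1# * ((- 1#) ^ toℕ i * f X)
      ≈⟨ *-assoc _ _ _ ⟨
    (- 1#) ^ toℕ (suc i) * f X ∎
    where open IsAlternating f-alt

  -- The Laplace expansion is alternating.

  minor : ∀ {k l} → Matrix (suc k) (suc l) → Fin (suc l) → Matrix k l
  minor X j r = removeAt (X (suc r)) j

  det-cong : ∀ {k} {X Z : Matrix k k} → X ≋ Z → det X ≈ det Z
  det-cong {zero}  X≋Z = refl
  det-cong {suc k} X≋Z = sum-cong-≋ λ j →
    *-cong (*-congˡ {(- 1#) ^ toℕ j} (X≋Z zero j)) (det-cong (λ r c → X≋Z (suc r) (punchIn j c)))

  det-linear : ∀ {k} i a {X Y Z : Matrix k k} → (∀ r → r ≢ i → X r ≋ᵥ Z r) → (∀ r → r ≢ i → Y r ≋ᵥ Z r) →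
               (∀ c → Z i c ≈ a * X i c + Y i c) → det Z ≈ a * det X + det Y
  det-linear {suc k} i a {X} {Y} {Z} X≋Z Y≋Z Zᵢ = begin
    det Z
      ≈⟨ sum-cong-≋ (term i X≋Z Y≋Z Zᵢ) ⟩
    sum (λ j → a * x j + y j)
      ≈⟨ ∑-distrib-+ (λ j → a * x j) y ⟩
    sum (λ j → a * x j) + det Y
      ≈⟨ +-congʳ (*-distribˡ-sum a x) ⟨
    a * det X + det Y ∎
    where
    x y : Vector Carrier (suc k)
    x j = (- 1#) ^ toℕ j * X zero j * det (minor X j)
    y j = (- 1#) ^ toℕ j * Y zero j * det (minor Y j)
    term : ∀ i → (∀ r → r ≢ i → X r ≋ᵥ Z r) → (∀ r → r ≢ i → Y r ≋ᵥ Z r) →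
           (∀ c → Z i c ≈ a * X i c + Y i c) →
           ∀ j → (- 1#) ^ toℕ j * Z zero j * det (minor Z j) ≈ a * x j + y j
    term zero X≋Z Y≋Z Zᵢ j = begin
      s * Z zero j * det (minor Z j)
        ≈⟨ *-congʳ (*-congˡ (Zᵢ j)) ⟩
      s * (a * X zero j + Y zero j) * det (minor Z j)
        ≈⟨ solve 5 (λ s a x y d → s :* (a :* x :+ y) :* d := a :* (s :* x :* d) :+ s :* y :* d) refl s a (X zero j) (Y zero j) _ ⟩
      a * (s * X zero j * det (minor Z j)) + s * Y zero j * det (minor Z j)
        ≈⟨ +-cong (*-congˡ (*-congˡ (det-cong (λ r c → X≋Z (suc r) (λ ()) _)))) (*-congˡ (det-cong (λ r c → Y≋Z (suc r) (λ ()) _))) ⟨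
      a * x j + y j ∎
      where s = (- 1#) ^ toℕ j
    term (suc i) X≋Z Y≋Z Zᵢ j = begin
      s * Z zero j * det (minor Z j)
        ≈⟨ *-congˡ (det-linear i a {minor X j} {minor Y j} (λ r r≢i c → X≋Z (suc r) (r≢i ∘ suc-injective) _)
             (λ r r≢i c → Y≋Z (suc r) (r≢i ∘ suc-injective) _) (λ c → Zᵢ (punchIn j c))) ⟩
      s * Z zero j * (a * det (minor X j) + det (minor Y j))
        ≈⟨ solve 5 (λ s a z d e → s :* z :* (a :* d :+ e) := a :* (s :* z :* d) :+ s :* z :* e) refl s a (Z zero j) _ _ ⟩
      a * (s * Z zero j * det (minor X j)) + s * Z zero j * det (minor Y j)
        ≈⟨ +-cong (*-congˡ (*-congʳ (*-congˡ (X≋Z zero (λ ()) j)))) (*-congʳ (*-congˡ (Y≋Z zero (λ ()) j))) ⟨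
      a * x j + y j ∎
      where s = (- 1#) ^ toℕ j

  det-multilinear : ∀ {k} → IsMultilinear (det {k})
  det-multilinear = record { cong = det-cong ; linear = det-linear }

  -- In the expansion of a determinant along two equal rows w, deleting the
  -- columns j and then punchIn j l leaves the same columns as deleting them in
  -- the other order, with the opposite sign; F is the complementary minor as a
  -- function of the columns that are left.
  double-expansion : ∀ {k} (w : Vector Carrier (suc (suc k))) (F : (Fin k → Fin (suc (suc k))) → Carrier) →
    (∀ {σ τ} → (∀ c → σ c ≡ τ c) → F σ ≈ F τ) →
    sum (λ j → (- 1#) ^ toℕ j * w j *
      sum (λ l → (- 1#) ^ toℕ l * w (punchIn j l) * F (punchIn j ∘ punchIn l))) ≈ 0#
  double-expansion {k} w F F-cong = begin
    -- A pair of deleted columns containing column `zero` occurs once with `zero` deleted first and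
    -- once with it deleted second; these terms cancel. The remaining pairs form the same sum for
    -- `tail w`.
    1# * w zero * sum (λ l → s l * w′ l * D l)
      + sum (λ j → - 1# * s j * w′ j * (1# * w zero * D j + sum (λ l → - 1# * sgn l * w (suc (punchIn j l)) * F (punchIn (suc j) ∘ punchIn (suc l)))))
      ≈⟨ +-cong (*-distribˡ-sum (1# * w zero) (λ l → s l * w′ l * D l))
           (sum-cong-≋ λ j → trans (*-congˡ {(- 1#) * s j * w′ j} (+-congˡ (sum-neg j)))
              (solve 6 (λ o w₀ s v d b → :- o :* s :* v :* (o :* w₀ :* d :+ :- o :* b)
                          := :- (o :* o :* (w₀ :* (s :* v :* d))) :+ o :* o :* (s :* v :* b))
                 refl 1# (w zero) (s j) (w′ j) (D j) (B j))) ⟩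
    sum (λ l → 1# * w zero * (s l * w′ l * D l))
      + sum (λ j → - (1# * 1# * (w zero * (s j * w′ j * D j))) + 1# * 1# * (s j * w′ j * B j))
      ≈⟨ ∑-distrib-+ (λ l → 1# * w zero * (s l * w′ l * D l))
           (λ j → - (1# * 1# * (w zero * (s j * w′ j * D j))) + 1# * 1# * (s j * w′ j * B j)) ⟨
    sum (λ j → 1# * w zero * (s j * w′ j * D j)
                + (- (1# * 1# * (w zero * (s j * w′ j * D j))) + 1# * 1# * (s j * w′ j * B j)))
      ≈⟨ sum-cong-≋ (λ j → trans (+-cong (*-congʳ {s j * w′ j * D j} (*-identityˡ (w zero)))
             (+-cong (-‿cong (1*1* (w zero * (s j * w′ j * D j)))) (1*1* (s j * w′ j * B j))))
           (solve 3 (λ w₀ x y → w₀ :* x :+ (:- (w₀ :* x) :+ y) := y) refl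
              (w zero) (s j * w′ j * D j) (s j * w′ j * B j))) ⟩
    sum (λ j → s j * w′ j * B j)
      ≈⟨ remaining k w F F-cong ⟩
    0# ∎
    where
    s : Vector Carrier (suc k)
    s j = (- 1#) ^ toℕ j
    sgn : Vector Carrier k
    sgn j = (- 1#) ^ toℕ j
    w′ : Vector Carrier (suc k)
    w′ = tail w
    D : Vector Carrier (suc k)
    D l = F (suc ∘ punchIn l)
    b : Fin (suc k) → Fin k → Carrier
    b j l = sgn l * w (suc (punchIn j l)) * F (punchIn (suc j) ∘ punchIn (suc l))
    B : Vector Carrier (suc k)
    B j = sum (b j)
    1*1* : ∀ x → 1# * 1# * x ≈ x
    1*1* x = trans (*-assoc _ _ _) (trans (*-identityˡ _) (*-identityˡ x))
    sum-neg : ∀ j → sum (λ l → - 1# * sgn l * w (suc (punchIn j l)) * F (punchIn (suc j) ∘ punchIn (suc l))) ≈ - 1# * B j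
    sum-neg j = trans
      (sum-cong-≋ λ l → trans (*-congʳ (*-assoc (- 1#) (sgn l) (w (suc (punchIn j l))))) (*-assoc (- 1#) _ _))
      (sym (*-distribˡ-sum (- 1#) (b j)))
    remaining : ∀ k (w : Vector Carrier (suc (suc k))) (F : (Fin k → Fin (suc (suc k))) → Carrier) →
      (∀ {σ τ} → (∀ c → σ c ≡ τ c) → F σ ≈ F τ) →
      sum (λ j → (- 1#) ^ toℕ j * w (suc j) *
        sum (λ l → (- 1#) ^ toℕ l * w (suc (punchIn j l)) * F (punchIn (suc j) ∘ punchIn (suc l)))) ≈ 0#
    remaining zero    w F F-cong = trans (+-identityʳ _) (zeroʳ _)
    remaining (suc k) w F F-cong = trans
      (sum-cong-≋ λ j → *-congˡ {(- 1#) ^ toℕ j * w (suc j)} (sum-cong-≋ λ l →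
        *-congˡ {(- 1#) ^ toℕ l * w (suc (punchIn j l))} (F-cong {punchIn (suc j) ∘ punchIn (suc l)} {lift (punchIn j ∘ punchIn l)}
          λ { zero → ≡.refl ; (suc c) → ≡.refl })))
      (double-expansion (tail w) (F ∘ lift) λ {σ} {τ} σ≗τ → F-cong {lift σ} {lift τ} λ { zero → ≡.refl ; (suc c) → ≡.cong suc (σ≗τ c) })
      where
      -- Neither deleted column is `zero`, so `zero` always survives as the first of the columns
      -- that are left.
      lift : (Fin k → Fin (suc (suc k))) → Fin (suc k) → Fin (suc (suc (suc k)))
      lift τ zero    = zero
      lift τ (suc c) = suc (τ c)

  det-vanish₀₁ : ∀ {k} {X : Matrix (suc (suc k)) (suc (suc k))} → X zero ≋ᵥ X (suc zero) → det X ≈ 0#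
  det-vanish₀₁ {X = X} X₀≋X₁ = trans
    (sum-cong-≋ λ j → *-congˡ {(- 1#) ^ toℕ j * X zero j} (sum-cong-≋ λ l →
      *-congʳ {det (minor (minor X j) l)} (*-congˡ {(- 1#) ^ toℕ l} (sym (X₀≋X₁ (punchIn j l))))))
    (double-expansion (X zero) (λ τ → det (λ r c → X (suc (suc r)) (τ c)))
      λ σ≗τ → det-cong λ r c → reflexive (≡.cong (X (suc (suc r))) (σ≗τ c)))

  -- The minors are alternating by induction. Exchanging the second row with the row equal to the
  -- first therefore only changes the sign, and makes the two equal rows adjacent at the top.
  det-vanish₀ : ∀ {k} → IsAlternating (det {k}) → ∀ {X : Matrix (suc k) (suc k)} j →
                X zero ≋ᵥ X (suc j) → det X ≈ 0#
  det-vanish₀ IH {X} zero X₀≋X₁ = det-vanish₀₁ {X = X} X₀≋X₁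
  det-vanish₀ {suc (suc k)} IH {X} (suc j) X₀≋Xⱼ = begin
    det X
      ≈⟨ sum-cong-≋ (λ c → *-congˡ {(- 1#) ^ toℕ c * X zero c} (minor-swap c)) ⟩
    sum (λ c → (- 1#) ^ toℕ c * X zero c * - det (minor X′ c))
      ≈⟨ sum-cong-≋ (λ c → -1*-comm ((- 1#) ^ toℕ c * X zero c) (det (minor X′ c))) ⟩
    sum (λ c → - 1# * ((- 1#) ^ toℕ c * X′ zero c * det (minor X′ c)))
      ≈⟨ *-distribˡ-sum (- 1#) (λ c → (- 1#) ^ toℕ c * X′ zero c * det (minor X′ c)) ⟨
    - 1# * det X′
      ≈⟨ *-congˡ (det-vanish₀₁ {X = X′} X₀≋Xⱼ) ⟩
    - 1# * 0#
      ≈⟨ zeroʳ _ ⟩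
    0# ∎
    where
    X′ : Matrix (suc (suc (suc k))) (suc (suc (suc k)))
    X′ = X zero ∷ (X (suc (suc j)) ∷ (tail (tail X) [ j ]≔ X (suc zero)))
    -1*-comm : ∀ a b → a * - b ≈ - 1# * (a * b)
    -1*-comm a b = trans (sym (-‿distribʳ-* a b)) (sym (-1*x≈-x _))
    minor-swap : ∀ c → det (minor X c) ≈ - det (minor X′ c)
    minor-swap c = Alternating.swap IH {minor X′ c} {minor X c} zero (suc j) (λ ())
      (λ d → sym (≔-updates (tail (tail X)) j _ _)) (λ _ → refl)
      λ { zero 0≢0 _ → contradiction ≡.refl 0≢0
        ; (suc r) _ r≢j d → sym (≔-minimal (tail (tail X)) j _ r (r≢j ∘ ≡.cong suc) _) }

  det-vanish : ∀ {k} → IsAlternating (det {k}) → ∀ {X : Matrix (suc k) (suc k)} i j →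
               i ≢ j → X i ≋ᵥ X j → det X ≈ 0#
  det-vanish IH     zero    zero    0≢0 _     = contradiction ≡.refl 0≢0
  det-vanish IH {X} zero    (suc j) _   X₀≋Xⱼ = det-vanish₀ IH {X} j X₀≋Xⱼ
  det-vanish IH {X} (suc i) zero    _   Xᵢ≋X₀ = det-vanish₀ IH {X} i λ c → sym (Xᵢ≋X₀ c)
  det-vanish IH {X} (suc i) (suc j) i≢j Xᵢ≋Xⱼ = sum-zero λ c → trans
    (*-congˡ {(- 1#) ^ toℕ c * X zero c}
      (vanish {minor X c} i j (i≢j ∘ ≡.cong suc) λ d → Xᵢ≋Xⱼ (punchIn c d))) (zeroʳ _)
    where open IsAlternating IH

  det-alternating : ∀ {k} → IsAlternating (det {k})
  det-alternating {zero}  = record { isMultilinear = det-multilinear ; vanish = λ () }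
  det-alternating {suc k} = record
    { isMultilinear = det-multilinear
    ; vanish        = λ {X} → det-vanish det-alternating {X}
    }

  -- Uniqueness of alternating functions, and multiplicativity of the determinant.

  insertAt-cong : ∀ {k} {u v : Vector Carrier k} i {a} → u ≋ᵥ v → insertAt u i a ≋ᵥ insertAt v i a
  insertAt-cong {k}     zero    u≋v zero    = refl
  insertAt-cong {k}     zero    u≋v (suc j) = u≋v j
  insertAt-cong {suc k} (suc i) u≋v zero    = u≋v zero
  insertAt-cong {suc k} (suc i) u≋v (suc j) = insertAt-cong i (u≋v ∘ suc) j

  insertAt-zero : ∀ {k} (i : Fin (suc k)) c → insertAt {n = k} (λ _ → 0#) i 0# c ≈ 0#
  insertAt-zero {k}     zero    zero    = refl
  insertAt-zero {k}     zero    (suc c) = refl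
  insertAt-zero {suc k} (suc i) zero    = refl
  insertAt-zero {suc k} (suc i) (suc c) = insertAt-zero i c

  removeAt-𝟙 : ∀ {k} (j : Fin (suc k)) r → removeAt 𝟙 j r ≋ᵥ insertAt (𝟙 r) j 0#
  removeAt-𝟙 {k}     zero    r       zero    = refl
  removeAt-𝟙 {k}     zero    r       (suc c) = 𝟙-suc r c
  removeAt-𝟙 {suc k} (suc j) zero    zero    = refl
  removeAt-𝟙 {suc k} (suc j) zero    (suc c) = sym (trans (insertAt-cong j (λ _ → refl) c) (insertAt-zero j c))
  removeAt-𝟙 {suc k} (suc j) (suc r) zero    = refl
  removeAt-𝟙 {suc k} (suc j) (suc r) (suc c) = trans (𝟙-suc (punchIn j r) c)
    (trans (removeAt-𝟙 j r c) (insertAt-cong j (λ d → sym (𝟙-suc r d)) c))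

  clear-column : ∀ {k} (v : Vector Carrier (suc k)) j c → v c ≈ v j * 𝟙 j c + insertAt (removeAt v j) j 0# c
  clear-column v zero    zero    = sym (trans (+-identityʳ _) (*-identityʳ _))
  clear-column v zero    (suc c) = sym (trans (+-congʳ (zeroʳ _)) (+-identityˡ _))
  clear-column {suc k} v (suc j) zero    = sym (trans (+-congʳ (zeroʳ _)) (+-identityˡ _))
  clear-column {suc k} v (suc j) (suc c) = trans (clear-column (tail v) j c)
    (+-congʳ (*-congˡ (sym (𝟙-suc j c))))

  insert-column-alternating : ∀ {k l} {f : Matrix k (suc l) → Carrier} → IsAlternating f →
                              ∀ j → IsAlternating (λ X → f (λ r → insertAt (X r) j 0#))
  insert-column-alternating f-alt j = record
    { isMultilinear = record
      { cong   = λ X≋Z → cong λ r → insertAt-cong j (X≋Z r)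
      ; linear = λ i a X≋Z Y≋Z Zᵢ → linear i a
          (λ r r≢i → insertAt-cong j (X≋Z r r≢i)) (λ r r≢i → insertAt-cong j (Y≋Z r r≢i)) (row a j Zᵢ)
      }
    ; vanish = λ i i′ i≢i′ Xᵢ≋ → vanish i i′ i≢i′ (insertAt-cong j Xᵢ≋)
    }
    where
    open IsAlternating f-alt
    row : ∀ {k} {x y z : Vector Carrier k} a j → (∀ c → z c ≈ a * x c + y c) →
          ∀ c → insertAt z j 0# c ≈ a * insertAt x j 0# c + insertAt y j 0# c
    row {k}     a zero    z≈ zero    = sym (trans (+-identityʳ _) (zeroʳ _))
    row {k}     a zero    z≈ (suc c) = z≈ c
    row {suc k} a (suc j) z≈ zero    = z≈ zero
    row {suc k} a (suc j) z≈ (suc c) = row a j (z≈ ∘ suc) c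

  -- Expanding the first row in unit vectors reproduces the Laplace expansion. With first row `𝟙 j`,
  -- column `j` can be cleared from the other rows; what is left is an alternating function of the
  -- minor, to which induction applies. `move-row` then puts the rows of the identity back in order.
  alternating-unique : ∀ {k} {f : Matrix k k → Carrier} → IsAlternating f → ∀ X → f X ≈ det X * f 𝟙
  alternating-unique {zero}  f-alt X = trans (IsAlternating.cong f-alt λ ()) (sym (*-identityˡ _))
  alternating-unique {suc k} {f} f-alt X = begin
    f X
      ≈⟨ cong (λ { zero c → sym (⋆-𝟙 (X zero) c) ; (suc r) c → refl }) ⟩
    f (X [ zero ]≔ (X zero ⋆ 𝟙))
      ≈⟨ ≔-⋆ X zero (X zero) 𝟙 ⟩
    sum (λ j → X zero j * f (X [ zero ]≔ 𝟙 j))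
      ≈⟨ sum-cong-≋ (λ j → trans (*-congˡ {X zero j} (first-row j))
           (solve 4 (λ x d s e → x :* (d :* (s :* e)) := s :* x :* d :* e) refl
              (X zero j) (det (minor X j)) ((- 1#) ^ toℕ j) (f 𝟙))) ⟩
    sum (λ j → (- 1#) ^ toℕ j * X zero j * det (minor X j) * f 𝟙)
      ≈⟨ *-distribʳ-sum (f 𝟙) (λ j → (- 1#) ^ toℕ j * X zero j * det (minor X j)) ⟨
    det X * f 𝟙 ∎
    where
    open IsAlternating f-alt
    open Alternating f-alt
    first-row : ∀ j → f (X [ zero ]≔ 𝟙 j) ≈ det (minor X j) * ((- 1#) ^ toℕ j * f 𝟙)
    first-row j = begin
      f (X [ zero ]≔ 𝟙 j)
        ≈⟨ cong (λ { zero c → refl ; (suc r) c → refl }) ⟩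
      f (𝟙 j ∷ tail X)
        ≈⟨ clear-rows (IsAlternating.isMultilinear (cons-alternating f-alt (𝟙 j))) (𝟙 j)
             (λ r T≋ → vanish zero (suc r) (λ ()) λ c → sym (T≋ c))
             (λ r → X (suc r) j) (λ r → clear-column (X (suc r)) j) ⟩
      f (𝟙 j ∷ (λ r → insertAt (minor X j r) j 0#))
        ≈⟨ alternating-unique (insert-column-alternating (cons-alternating f-alt (𝟙 j)) j) (minor X j) ⟩
      det (minor X j) * f (𝟙 j ∷ (λ r → insertAt (𝟙 r) j 0#))
        ≈⟨ *-congˡ (cong (λ { zero c → refl ; (suc r) c → removeAt-𝟙 j r c })) ⟨
      det (minor X j) * f (𝟙 j ∷ removeAt 𝟙 j)
        ≈⟨ *-congˡ (move-row f-alt 𝟙 j) ⟩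
      det (minor X j) * ((- 1#) ^ toℕ j * f 𝟙) ∎

  det-𝟙 : ∀ k → det (𝟙 {k}) ≈ 1#
  det-𝟙 zero    = refl
  det-𝟙 (suc k) = begin
    1# * 1# * det (minor (𝟙 {suc k}) zero) + sum (λ j → - 1# * (- 1#) ^ toℕ j * 0# * det (minor (𝟙 {suc k}) (suc j)))
      ≈⟨ +-cong (*-cong (*-identityˡ 1#) (trans (det-cong {X = minor (𝟙 {suc k}) zero} 𝟙-suc) (det-𝟙 k)))
           (sum-zero {f = λ j → - 1# * (- 1#) ^ toℕ j * 0# * det (minor (𝟙 {suc k}) (suc j))}
             λ j → trans (*-congʳ {det (minor (𝟙 {suc k}) (suc j))} (zeroʳ _)) (zeroˡ _)) ⟩
    1# * 1# + 0#
      ≈⟨ +-identityʳ _ ⟩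
    1# * 1#
      ≈⟨ *-identityˡ 1# ⟩
    1# ∎

  -- For fixed `Z`, the left side is an alternating function of the rows of `X` with value `det Z`
  -- at `𝟙`.
  det-· : ∀ {k} (X Z : Matrix k k) → det (X · Z) ≈ det X * det Z
  det-· {k} X Z = trans (alternating-unique f-alt X) (*-congˡ (det-cong (λ i → 𝟙-⋆ i Z)))
    where
    open IsAlternating (det-alternating {k})
    f-alt : IsAlternating (λ X → det (X · Z))
    f-alt = record
      { isMultilinear = record
        { cong   = λ X≋X′ → cong λ r → ⋆-congˡ Z (X≋X′ r)
        ; linear = λ i a X≋ Y≋ Zᵢ → linear i a
            (λ r r≢i → ⋆-congˡ Z (X≋ r r≢i)) (λ r r≢i → ⋆-congˡ Z (Y≋ r r≢i))
            (λ c → trans (⋆-congˡ Z Zᵢ c) (⋆-linear a _ _ Z c))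
        }
      ; vanish = λ i j i≢j Xᵢ≋Xⱼ → vanish i j i≢j (⋆-congˡ Z Xᵢ≋Xⱼ)
      }

  left-inverse⇒det#0 : ∀ {k} {X Z : Matrix k k} → Z · X ≋ 𝟙 → det X # 0#
  left-inverse⇒det#0 {k} {X} {Z} ZX≋𝟙 = xy≈1⇒x#0 (begin
    det X * det Z ≈⟨ *-comm _ _ ⟩
    det Z * det X ≈⟨ det-· Z X ⟨
    det (Z · X)   ≈⟨ det-cong ZX≋𝟙 ⟩
    det (𝟙 {k})        ≈⟨ det-𝟙 k ⟩
    1#            ∎)

-- Bilinear forms, bordered Gram determinants and positive matrices.

module Forms {ℓ} (R : RealNumbers ℓ) where

  open Reals R
  open OverReals R
  open Determinant R
  open ≈-Reasoning

  punchIn-fromℕ : ∀ {k} (c : Fin k) → punchIn (fromℕ k) c ≡ inject₁ c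
  punchIn-fromℕ zero    = ≡.refl
  punchIn-fromℕ (suc c) = ≡.cong suc (punchIn-fromℕ c)

  punchIn-inject₁-fromℕ : ∀ {k} (j : Fin (suc k)) → punchIn (inject₁ j) (fromℕ k) ≡ fromℕ (suc k)
  punchIn-inject₁-fromℕ         zero    = ≡.refl
  punchIn-inject₁-fromℕ {suc k} (suc j) = ≡.cong suc (punchIn-inject₁-fromℕ j)

  punchIn-inject₁ : ∀ {k} (j : Fin (suc k)) (c : Fin k) → punchIn (inject₁ j) (inject₁ c) ≡ inject₁ (punchIn j c)
  punchIn-inject₁ zero    c       = ≡.refl
  punchIn-inject₁ (suc j) zero    = ≡.refl
  punchIn-inject₁ (suc j) (suc c) = ≡.cong suc (punchIn-inject₁ j c)

  insertAt-fromℕ-inject₁ : ∀ {a} {A : Set a} {k} (xs : Vector A k) v i → insertAt xs (fromℕ k) v (inject₁ i) ≡ xs i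
  insertAt-fromℕ-inject₁ {k = k} xs v i = ≡.trans
    (≡.cong (insertAt xs (fromℕ k) v) (≡.sym (punchIn-fromℕ i)))
    (insertAt-punchIn xs (fromℕ k) v i)

  -- Expansion along the first row passes the zeros of the last row on to the minors, so induction
  -- applies to every term but that of the last column, whose minor has a zero row.
  det-block : ∀ {k} (W : Matrix (suc k) (suc k)) → (∀ c → W (fromℕ k) (inject₁ c) ≈ 0#) →
              det W ≈ det (λ r c → W (inject₁ r) (inject₁ c)) * W (fromℕ k) (fromℕ k)
  det-block {zero}  W z = trans (+-identityʳ _) (*-identityʳ _)
  det-block {suc k} W z = begin
    det W
      ≈⟨ sum-init-last term ⟩
    sum (λ j → term (inject₁ j)) + term (fromℕ (suc k))
      ≈⟨ +-cong (sum-cong-≋ init) last-term ⟩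
    sum (λ j → (- 1#) ^ toℕ j * W zero (inject₁ j) * det (minor W° j) * e) + 0#
      ≈⟨ +-identityʳ _ ⟩
    sum (λ j → (- 1#) ^ toℕ j * W zero (inject₁ j) * det (minor W° j) * e)
      ≈⟨ *-distribʳ-sum e (λ j → (- 1#) ^ toℕ j * W zero (inject₁ j) * det (minor W° j)) ⟨
    det W° * e ∎
    where
    W° : Matrix (suc k) (suc k)
    W° r c = W (inject₁ r) (inject₁ c)
    e : Carrier
    e = W (fromℕ (suc k)) (fromℕ (suc k))
    term : Vector Carrier (suc (suc k))
    term j = (- 1#) ^ toℕ j * W zero j * det (minor W j)
    last-term : term (fromℕ (suc k)) ≈ 0#
    last-term = trans (*-congˡ {(- 1#) ^ toℕ (fromℕ (suc k)) * W zero (fromℕ (suc k))}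
      (IsMultilinear.zero-row det-multilinear {minor W (fromℕ (suc k))} (fromℕ k) λ c →
        trans (reflexive (≡.cong (W (fromℕ (suc k))) (punchIn-fromℕ c))) (z c))) (zeroʳ _)
    init : ∀ j → term (inject₁ j) ≈ (- 1#) ^ toℕ j * W zero (inject₁ j) * det (minor W° j) * e
    init j = begin
      term (inject₁ j)
        ≈⟨ *-cong (*-congʳ (reflexive (≡.cong ((- 1#) ^_) (toℕ-inject₁ j))))
             (det-block (minor W (inject₁ j)) λ c →
               trans (reflexive (≡.cong (W (fromℕ (suc k))) (punchIn-inject₁ j c))) (z (punchIn j c))) ⟩
      s * (det (λ r c → W (suc (inject₁ r)) (punchIn (inject₁ j) (inject₁ c))) * W (fromℕ (suc k)) (punchIn (inject₁ j) (fromℕ k)))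
        ≈⟨ *-congˡ (*-cong
             (det-cong λ r c → reflexive (≡.cong (W (suc (inject₁ r))) (punchIn-inject₁ j c)))
             (reflexive (≡.cong (W (fromℕ (suc k))) (punchIn-inject₁-fromℕ j)))) ⟩
      s * (det (minor W° j) * e)
        ≈⟨ *-assoc _ _ _ ⟨
      s * det (minor W° j) * e ∎
      where
      s : Carrier
      s = (- 1#) ^ toℕ j * W zero (inject₁ j)

  dot : ∀ {k} → Vector Carrier k → Vector Carrier k → Carrier
  dot u v = sum (λ e → u e * v e)

  form : ∀ {k} → Matrix k k → Vector Carrier k → Vector Carrier k → Carrier
  form B u v = dot (u ⋆ B) v

  dot-cong : ∀ {k} {u u′ v v′ : Vector Carrier k} → u ≋ᵥ u′ → v ≋ᵥ v′ → dot u v ≈ dot u′ v′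
  dot-cong u≋ v≋ = sum-cong-≋ λ e → *-cong (u≋ e) (v≋ e)

  dot-comm : ∀ {k} (u v : Vector Carrier k) → dot u v ≈ dot v u
  dot-comm u v = sum-cong-≋ λ e → *-comm (u e) (v e)

  dot-⋆ˡ : ∀ {k l} (x : Vector Carrier k) (X : Matrix k l) v → dot (x ⋆ X) v ≈ dot x (λ i → dot (X i) v)
  -- The vector `v` is read as a matrix with one column.
  dot-⋆ˡ x X v = ⋆-assoc x X (λ e (_ : Fin 1) → v e) zero

  dot-⋆ʳ : ∀ {k l} u (x : Vector Carrier k) (X : Matrix k l) → dot u (x ⋆ X) ≈ dot x (λ i → dot u (X i))
  dot-⋆ʳ u x X = trans (dot-comm u _) (trans (dot-⋆ˡ x X u) (dot-cong {u = x} (λ _ → refl) λ i → dot-comm (X i) u))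

  dot-linearˡ : ∀ {k} a (u u′ v : Vector Carrier k) → dot (λ e → a * u e + u′ e) v ≈ a * dot u v + dot u′ v
  dot-linearˡ a u u′ v = ⋆-linear a u u′ (λ e (_ : Fin 1) → v e) zero

  form-cong : ∀ {k} (B : Matrix k k) {u u′ v v′} → u ≋ᵥ u′ → v ≋ᵥ v′ → form B u v ≈ form B u′ v′
  form-cong B u≋ v≋ = dot-cong (⋆-congˡ B u≋) v≋

  form-⋆ˡ : ∀ {k l} (B : Matrix l l) (x : Vector Carrier k) X v → form B (x ⋆ X) v ≈ dot x (λ i → form B (X i) v)
  form-⋆ˡ B x X v = trans (dot-cong {v = v} (⋆-assoc x X B) (λ _ → refl)) (dot-⋆ˡ x (X · B) v)

  form-linearˡ : ∀ {k} (B : Matrix k k) a u u′ v → form B (λ e → a * u e + u′ e) v ≈ a * form B u v + form B u′ v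
  form-linearˡ B a u u′ v = trans (dot-cong {v = v} (⋆-linear a u u′ B) (λ _ → refl)) (dot-linearˡ a _ _ v)

  form-linearʳ : ∀ {k} (B : Matrix k k) a u v v′ → form B u (λ e → a * v e + v′ e) ≈ a * form B u v + form B u v′
  form-linearʳ B a u v v′ = trans (dot-comm (u ⋆ B) _)
    (trans (dot-linearˡ a v v′ (u ⋆ B)) (+-cong (*-congˡ (dot-comm v _)) (dot-comm v′ _)))

  form-⊕ : ∀ {k} (B A : Matrix k k) u v → form (B ⊕ A) u v ≈ form B u v + form A u v
  form-⊕ B A u v = trans
    (sum-cong-≋ λ e → trans
      (*-congʳ {v e} (trans (sum-cong-≋ λ i → distribˡ (u i) (B i e) (A i e)) (∑-distrib-+ (λ i → u i * B i e) _)))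
      (distribʳ (v e) ((u ⋆ B) e) ((u ⋆ A) e)))
    (∑-distrib-+ (λ e → (u ⋆ B) e * v e) _)

  ⋆-diag : ∀ {k} (u y : Vector Carrier k) e → (u ⋆ diag y) e ≈ u e * y e
  ⋆-diag u y e = trans (sum-single _ e (λ i i≢e → trans (*-congˡ (off i i≢e)) (zeroʳ _))) (*-congˡ on)
    where
    off : ∀ i → i ≢ e → diag y i e ≈ 0#
    off i i≢e with i ≟ e
    ... | yes i≡e = contradiction i≡e i≢e
    ... | no  _   = refl
    on : diag y e e ≈ y e
    on with e ≟ e
    ... | yes _   = refl
    ... | no  e≢e = contradiction ≡.refl e≢e

  form-diag : ∀ {k} (y u v : Vector Carrier k) → form (diag y) u v ≈ sum (λ e → y e * (u e * v e))
  form-diag y u v = sum-cong-≋ λ e → trans (*-congʳ (⋆-diag u y e))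
    (trans (*-congʳ (*-comm (u e) (y e))) (*-assoc (y e) (u e) (v e)))

  form-diag-comm : ∀ {k} (y u v : Vector Carrier k) → form (diag y) u v ≈ form (diag y) v u
  form-diag-comm y u v = trans (form-diag y u v)
    (trans (sum-cong-≋ λ e → *-congˡ (*-comm (u e) (v e))) (sym (form-diag y v u)))

  -- With b = (x, 1) one has b N = g, so replacing the last row of N B Nᵀ by its combination with
  -- coefficients b turns that row into the pairings of g with the rows of N. The coefficient 1
  -- preserves the determinant, and orthogonality makes the matrix block triangular.
  det-appendRow : ∀ {k m} (B : Matrix m m) (M : Matrix k m) (ω : Vector Carrier m) (x : Vector Carrier k) →
    let N = appendRow M ω
        g = λ e → (x ⋆ M) e + ω e
    in (∀ i → form B g (M i) ≈ 0#) →
    det (N · B · N ᵀ) ≈ det (M · B · M ᵀ) * form B g ω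
  det-appendRow {k} B M ω x orth = begin
    det W
      ≈⟨ *-identityˡ _ ⟨
    1# * det W
      ≈⟨ *-congʳ (reflexive (insertAt-lookup x last 1#)) ⟨
    b last * det W
      ≈⟨ Alternating.row-operation det-alternating W last b ⟨
    det W′
      ≈⟨ det-block W′ (λ c → trans (W′-last (inject₁ c))
           (trans (reflexive (≡.cong (form B g) (insertAt-fromℕ-inject₁ M ω c))) (orth c))) ⟩
    det (λ r c → W′ (inject₁ r) (inject₁ c)) * W′ last last
      ≈⟨ *-cong (det-cong λ r c → trans
            (≔-minimal W last (b ⋆ W) (inject₁ r) (fromℕ≢inject₁ ∘ ≡.sym) (inject₁ c))
            (reflexive (≡.cong₂ (form B) (insertAt-fromℕ-inject₁ M ω r) (insertAt-fromℕ-inject₁ M ω c))))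
           (trans (W′-last last) (reflexive (≡.cong (form B g) (insertAt-lookup M last ω)))) ⟩
    det (M · B · M ᵀ) * form B g ω ∎
    where
    last : Fin (suc k)
    last = fromℕ k
    N : Matrix (suc k) _
    N = appendRow M ω
    g : Vector Carrier _
    g e = (x ⋆ M) e + ω e
    W W′ : Matrix (suc k) (suc k)
    W = N · B · N ᵀ
    b : Vector Carrier (suc k)
    b = insertAt x last 1#
    W′ = W [ last ]≔ (b ⋆ W)
    b⋆N : b ⋆ N ≋ᵥ g
    b⋆N e = trans (sum-init-last (λ i → b i * N i e)) (+-cong
      (sum-cong-≋ λ i → *-cong (reflexive (insertAt-fromℕ-inject₁ x 1# i))
        (reflexive (≡.cong (λ r → r e) (insertAt-fromℕ-inject₁ M ω i))))
      (trans (*-cong (reflexive (insertAt-lookup x last 1#))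
        (reflexive (≡.cong (λ r → r e) (insertAt-lookup M last ω)))) (*-identityˡ _)))
    W′-last : ∀ c → W′ last c ≈ form B g (N c)
    W′-last c = begin
      W′ last c           ≈⟨ ≔-updates W last (b ⋆ W) c ⟩
      (b ⋆ W) c           ≈⟨ form-⋆ˡ B b N (N c) ⟨
      form B (b ⋆ N) (N c) ≈⟨ form-cong B b⋆N (λ _ → refl) ⟩
      form B g (N c)      ∎

  -- The premise is apartness rather than inequality from zero. It holds for a unit vector, which is
  -- how a pivot is shown positive and hence invertible.
  IsPositive : ∀ {k} → Matrix k k → Set ℓ
  IsPositive X = ∀ x → (∃ λ i → x i # 0#) → 0# < form X x x

  module Elimination {k} {X : Matrix (suc k) (suc k)} (q : Carrier) (pq≈1 : X zero zero * q ≈ 1#) where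

    schur-complement : Matrix k k
    schur-complement i j = X (suc i) zero * - (q * X zero (suc j)) + X (suc i) (suc j)

    -- Found by solving the equation of column `zero`, with right-hand side `c`, for the coordinate
    -- to be put in front of `x`.
    lead : Carrier → Vector Carrier k → Carrier
    lead c x = (c - dot x (λ i → X (suc i) zero)) * q

    eliminate-zero : ∀ c x → ((lead c x ∷ x) ⋆ X) zero ≈ c
    eliminate-zero c x = begin
      (c - u) * q * X zero zero + u
        ≈⟨ +-congʳ (trans (*-assoc _ _ _) (*-congˡ (trans (*-comm _ _) pq≈1))) ⟩
      (c - u) * 1# + u
        ≈⟨ +-congʳ (*-identityʳ _) ⟩
      c - u + u
        ≈⟨ solve 2 (λ c u → c :- u :+ u := c) refl c u ⟩
      c ∎
      where u = dot x (λ i → X (suc i) zero)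

    eliminate-suc : ∀ c x j → ((lead c x ∷ x) ⋆ X) (suc j) ≈ (x ⋆ schur-complement) j + c * (q * X zero (suc j))
    eliminate-suc c x j = begin
      (c - u) * q * r + s
        ≈⟨ solve 5 (λ c u q r s → (c :- u) :* q :* r :+ s := u :* :- (q :* r) :+ s :+ c :* (q :* r)) refl c u q r s ⟩
      u * - (q * r) + s + c * (q * r)
        ≈⟨ +-congʳ (+-congʳ (trans (*-comm _ _) (*-distribˡ-sum (- (q * r)) (λ i → x i * X (suc i) zero)))) ⟩
      sum (λ i → - (q * r) * (x i * X (suc i) zero)) + s + c * (q * r)
        ≈⟨ +-congʳ (∑-distrib-+ (λ i → - (q * r) * (x i * X (suc i) zero)) _) ⟨
      sum (λ i → - (q * r) * (x i * X (suc i) zero) + x i * X (suc i) (suc j)) + c * (q * r)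
        ≈⟨ +-congʳ (sum-cong-≋ λ i → solve 4 (λ t x y z → t :* (x :* y) :+ x :* z := x :* (y :* t :+ z)) refl
             (- (q * r)) (x i) (X (suc i) zero) (X (suc i) (suc j))) ⟩
      (x ⋆ schur-complement) j + c * (q * r) ∎
      where
      u = dot x (λ i → X (suc i) zero)
      r = X zero (suc j)
      s = dot x (λ i → X (suc i) (suc j))

    -- Prepending `lead 0# x` makes the entry of the product in column `zero` vanish, so the form of
    -- `X` at the extended vector equals the form of the complement at `x`.
    schur-complement-positive : IsPositive X → IsPositive schur-complement
    schur-complement-positive X-pos x (i , xᵢ#0) = <-cong refl (begin
      form X x₊ x₊
        ≈⟨ +-cong (*-congʳ (eliminate-zero 0# x)) (sum-cong-≋ λ j → *-congʳ {x j} (eliminate-suc 0# x j)) ⟩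
      0# * lead 0# x + sum (λ j → ((x ⋆ schur-complement) j + 0# * (q * X zero (suc j))) * x j)
        ≈⟨ +-cong (zeroˡ _) (sum-cong-≋ λ j → *-congʳ {x j} (trans (+-congˡ (zeroˡ (q * X zero (suc j)))) (+-identityʳ ((x ⋆ schur-complement) j)))) ⟩
      0# + form schur-complement x x
        ≈⟨ +-identityˡ _ ⟩
      form schur-complement x x ∎) (X-pos x₊ (suc i , xᵢ#0))
      where
      x₊ : Vector Carrier (suc k)
      x₊ = lead 0# x ∷ x

  -- Elimination without row exchanges: the pivot is the value of the form at the first unit vector,
  -- and the Schur complement is positive again.
  positive⇒solvable : ∀ {k} {X : Matrix k k} → IsPositive X → ∀ b → ∃ λ x → x ⋆ X ≋ᵥ b
  positive⇒solvable {zero}      X-pos b = b , λ ()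
  positive⇒solvable {suc k} {X} X-pos b
    with #0⇒invertible (inj₂ (<-cong refl pivot (X-pos (𝟙 zero) (zero , inj₂ 0<1))))
    where
    pivot : form X (𝟙 zero) (𝟙 zero) ≈ X zero zero
    pivot = trans (dot-cong {v = 𝟙 zero} (𝟙-⋆ zero X) (λ _ → refl))
      (trans (+-cong (*-identityʳ _) (sum-zero λ j → zeroʳ (X zero (suc j)))) (+-identityʳ _))
  ... | q , _ , pq≈1
    with positive⇒solvable (Elimination.schur-complement-positive {X = X} q pq≈1 X-pos)
           (λ j → b (suc j) - b zero * (q * X zero (suc j)))
  ... | x , x⋆S = (lead (b zero) x ∷ x) , λ where
      zero    → eliminate-zero (b zero) x
      (suc j) → trans (eliminate-suc (b zero) x j) (trans (+-congʳ (x⋆S j))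
        (solve 2 (λ a t → a :- t :+ t := a) refl (b (suc j)) (b zero * (q * X zero (suc j)))))
    where open Elimination {X = X} q pq≈1

  -- The solutions for the unit vectors are the rows of a left inverse.
  positive⇒det#0 : ∀ {k} {X : Matrix k k} → IsPositive X → det X # 0#
  positive⇒det#0 {X = X} X-pos = left-inverse⇒det#0 {X = X} {Z = λ i → proj₁ (positive⇒solvable X-pos (𝟙 i))}
    λ i → proj₂ (positive⇒solvable X-pos (𝟙 i))

  -- The form at x is the sum of yₑ vₑ² with v = x M. As x = v T, a coordinate of x apart from zero
  -- yields a coordinate of v apart from zero, and that single term already makes the sum positive.
  gram-positive : ∀ {k m} (M : Matrix k m) (T : Matrix m k) → M · T ≋ 𝟙 →
                  ∀ (y : Vector Carrier m) → (∀ e → 0# < y e) → IsPositive (M · diag y · M ᵀ)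
  gram-positive M T MT≋𝟙 y 0<y x (i , xᵢ#0) = <-cong refl (sym gram)
    (<-≤-trans (*-pos (0<y e) (#0⇒0<² vₑ#0))
      (term≤sum {f = λ e → y e * (v e * v e)} (λ e → 0≤* (<⇒≤ (0<y e)) (0≤² (v e))) e))
    where
    v : Vector Carrier _
    v = x ⋆ M
    x≋ : x ≋ᵥ v ⋆ T
    x≋ j = sym (trans (⋆-assoc x M T j) (trans (sum-cong-≋ λ i → *-congˡ (MT≋𝟙 i j)) (⋆-𝟙 x j)))
    #-cong : ∀ {a b} → a ≈ b → a # 0# → b # 0#
    #-cong a≈b (inj₁ a<0) = inj₁ (<-cong a≈b refl a<0)
    #-cong a≈b (inj₂ 0<a) = inj₂ (<-cong refl a≈b 0<a)
    nonzero : ∃ λ e → v e * T e i # 0#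
    nonzero = sum-#0 (λ e → v e * T e i) (#-cong (x≋ i) xᵢ#0)
    e : Fin _
    e = proj₁ nonzero
    vₑ#0 : v e # 0#
    vₑ#0 = xy#0⇒x#0 (proj₂ nonzero)
    gram : form (M · diag y · M ᵀ) x x ≈ sum (λ e → y e * (v e * v e))
    gram = begin
      dot (x ⋆ (M · diag y · M ᵀ)) x
        ≈⟨ dot-cong {v = x} (λ j → form-⋆ˡ (diag y) x M (M j)) (λ _ → refl) ⟨
      dot (λ j → form (diag y) v (M j)) x
        ≈⟨ dot-comm _ x ⟩
      dot x (λ j → form (diag y) v (M j))
        ≈⟨ dot-⋆ʳ (v ⋆ diag y) x M ⟨
      form (diag y) v v
        ≈⟨ form-diag y v v ⟩
      sum (λ e → y e * (v e * v e)) ∎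

-- Walks, integral cycles and electrical flows on the graph.

module Flows {ℓ} (R : RealNumbers ℓ) {n m} (G : OrientedGraph n m) where

  open Reals R
  open OverReals R
  open Determinant R
  open Forms R
  open OrientedGraph G
  open ≈-Reasoning

  dot-sub : ∀ {k} (u v w : Vector Carrier k) → dot (λ e → u e - v e) w ≈ dot u w - dot v w
  dot-sub u v w = begin
    dot (λ e → u e - v e) w         ≈⟨ dot-cong {v = w} (λ e → trans (+-comm _ _) (+-congʳ (sym (-1*x≈-x (v e))))) (λ _ → refl) ⟩
    dot (λ e → - 1# * v e + u e) w  ≈⟨ dot-linearˡ (- 1#) v u w ⟩
    - 1# * dot v w + dot u w        ≈⟨ +-congʳ (-1*x≈-x _) ⟩
    - dot v w + dot u w             ≈⟨ +-comm _ _ ⟩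
    dot u w - dot v w               ∎

  dot-𝟙 : ∀ {k} i (w : Vector Carrier k) → dot (𝟙 i) w ≈ w i
  dot-𝟙 i w = 𝟙-⋆ i (λ v (_ : Fin 1) → w v) zero

  -- Arranged so that `∂ G x` unfolds to `x ⋆ incidence` and the lemmas on `_⋆_` apply to
  -- boundaries.
  incidence : Matrix m n
  incidence e v = indicator G (∂⁺ e) v - indicator G (∂⁻ e) v

  incidence-dot : ∀ e S → dot (incidence e) S ≈ S (∂⁺ e) - S (∂⁻ e)
  incidence-dot e S = trans (dot-sub (𝟙 (∂⁺ e)) (𝟙 (∂⁻ e)) S) (+-cong (dot-𝟙 (∂⁺ e) S) (-‿cong (dot-𝟙 (∂⁻ e) S)))

  unit : ∀ {k} → Fin k → Vector ℤ k
  unit e f with e ≟ f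
  ... | yes _ = 1ℤ
  ... | no  _ = 0ℤ

  fromℤ-unit : ∀ {k} (e f : Fin k) → fromℤ (unit e f) ≈ 𝟙 e f
  fromℤ-unit e f with e ≟ f
  ... | yes _ = fromℤ-1
  ... | no  _ = refl

  -- The 1-chain of a walk, an edge counting -1 when traversed backwards. It is integral because
  -- `spanning` speaks only of integral cycles.
  walk : ∀ {u v} → EqClosure Arc u v → Vector ℤ m
  walk ε                   f = 0ℤ
  walk (fwd (e , _) ◅ w)   f = unit e f ℤ.+ walk w f
  walk (bwd (e , _) ◅ w)   f = ℤ.- unit e f ℤ.+ walk w f

  ∂-walk : ∀ {u v} (w : EqClosure Arc u v) → ∂ G (fromℤ ∘ walk w) ≋ᵥ (λ t → indicator G v t - indicator G u t)
  ∂-walk {u} ε t = trans (sum-zero λ e → zeroˡ (incidence e t)) (sym (-‿inverseʳ _))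
  ∂-walk {v = v} (fwd (e , ≡.refl , ≡.refl) ◅ w) t = begin
    ∂ G (fromℤ ∘ (λ f → unit e f ℤ.+ walk w f)) t
      ≈⟨ ⋆-congˡ incidence (λ f → trans (fromℤ-+ (unit e f) (walk w f)) (+-congʳ (trans (fromℤ-unit e f) (sym (*-identityˡ _))))) t ⟩
    ((λ f → 1# * 𝟙 e f + fromℤ (walk w f)) ⋆ incidence) t
      ≈⟨ ⋆-linear 1# (𝟙 e) _ incidence t ⟩
    1# * (𝟙 e ⋆ incidence) t + ∂ G (fromℤ ∘ walk w) t
      ≈⟨ +-cong (trans (*-identityˡ _) (𝟙-⋆ e incidence t)) (∂-walk w t) ⟩
    (indicator G (∂⁺ e) t - indicator G (∂⁻ e) t) + (indicator G v t - indicator G (∂⁺ e) t)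
      ≈⟨ solve 3 (λ a b c → (a :- b) :+ (c :- a) := c :- b) refl (indicator G (∂⁺ e) t) (indicator G (∂⁻ e) t) (indicator G v t) ⟩
    indicator G v t - indicator G (∂⁻ e) t ∎
  ∂-walk {v = v} (bwd (e , ≡.refl , ≡.refl) ◅ w) t = begin
    ∂ G (fromℤ ∘ (λ f → ℤ.- unit e f ℤ.+ walk w f)) t
      ≈⟨ ⋆-congˡ incidence (λ f → trans (fromℤ-+ (ℤ.- unit e f) (walk w f)) (+-congʳ
           (trans (fromℤ-neg (unit e f)) (trans (-‿cong (fromℤ-unit e f)) (sym (-1*x≈-x _)))))) t ⟩
    ((λ f → - 1# * 𝟙 e f + fromℤ (walk w f)) ⋆ incidence) t
      ≈⟨ ⋆-linear (- 1#) (𝟙 e) _ incidence t ⟩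
    - 1# * (𝟙 e ⋆ incidence) t + ∂ G (fromℤ ∘ walk w) t
      ≈⟨ +-cong (trans (-1*x≈-x _) (-‿cong (𝟙-⋆ e incidence t))) (∂-walk w t) ⟩
    - (indicator G (∂⁺ e) t - indicator G (∂⁻ e) t) + (indicator G v t - indicator G (∂⁻ e) t)
      ≈⟨ solve 3 (λ a b c → :- (a :- b) :+ (c :- b) := c :- a) refl (indicator G (∂⁺ e) t) (indicator G (∂⁻ e) t) (indicator G v t) ⟩
    indicator G v t - indicator G (∂⁺ e) t ∎

  -- The level set of φ at the head of e₀ is a cut that every edge, e₀ among
  -- them, crosses in the direction of its flow. Since _≤_ is a negation,
  -- membership in the level set may be decided.
  potential-flow-bound :
    (y g : Vector Carrier m) (φ p κ : Vector Carrier n) → (∀ e → 0# < y e) →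
    (∀ e → y e * g e ≈ φ (∂⁺ e) - φ (∂⁻ e)) → ∂ G g ≋ᵥ p →
    (∀ v → 0# ≤ κ v) → (∀ v → p v ≤ κ v) → ∀ e → g e ≤ sum κ
  potential-flow-bound y g φ p κ 0<y yg≈ ∂g≋p 0≤κ p≤κ e₀ K<g =
    sequence (RawMonad.rawApplicative ¬¬-Monad) {P = λ v → Dec (φ v < φ (∂⁺ e₀))}
      (λ v → ¬¬-excluded-middle) λ below → cut below K<g
    where
    module _ (below : ∀ v → Dec (φ v < φ (∂⁺ e₀))) where
      above : ∀ {v} → Dec (φ v < φ (∂⁺ e₀)) → Carrier
      above (yes _) = 0#
      above (no  _) = 1#
      S : Vector Carrier n
      S v = above (below v)
      ascending : ∀ e → φ (∂⁻ e) < φ (∂⁺ e) → 0# ≤ g e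
      ascending e φ< = 0≤ab⇒0≤b (0<y e) (<⇒≤ (<-cong refl (sym (yg≈ e)) (a<b⇒0<b-a φ<)))
      descending : ∀ e → φ (∂⁺ e) < φ (∂⁻ e) → 0# ≤ - g e
      descending e φ< = 0≤ab⇒0≤b (0<y e) (<⇒≤ (<-cong refl
        (trans (solve 2 (λ a b → b :- a := :- (a :- b)) refl (φ (∂⁺ e)) (φ (∂⁻ e)))
          (trans (-‿cong (sym (yg≈ e))) (-‿distribʳ-* _ _))) (a<b⇒0<b-a φ<)))
      crossing-≥0 : ∀ e → 0# ≤ g e * (S (∂⁺ e) - S (∂⁻ e))
      crossing-≥0 e with below (∂⁺ e) | below (∂⁻ e)
      ... | yes _ | yes _ = ≤-reflexive (sym (trans (*-congˡ (-‿inverseʳ 0#)) (zeroʳ _)))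
      ... | no  _ | no  _ = ≤-reflexive (sym (trans (*-congˡ (-‿inverseʳ 1#)) (zeroʳ _)))
      ... | no φ₀≤φ⁺ | yes φ⁻<φ₀ = ≤-cong refl
        (sym (trans (*-congˡ (trans (+-congˡ -0#≈0#) (+-identityʳ 1#))) (*-identityʳ _)))
        (ascending e (<-≤-trans φ⁻<φ₀ φ₀≤φ⁺))
      ... | yes φ⁺<φ₀ | no φ₀≤φ⁻ = ≤-cong refl
        (sym (trans (*-congˡ (+-identityˡ _)) (trans (sym (-‿distribʳ-* _ _)) (-‿cong (*-identityʳ _)))))
        (descending e (<-≤-trans φ⁺<φ₀ φ₀≤φ⁻))
      -- The head of `e₀` lies on its own level, and a positive flow means that the potential rises
      -- strictly along `e₀`, so the tail lies below. Positivity is available because the bound is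
      -- proved by contradiction.
      crossing₀ : 0# < g e₀ → g e₀ ≈ g e₀ * (S (∂⁺ e₀) - S (∂⁻ e₀))
      crossing₀ 0<g with below (∂⁺ e₀) | below (∂⁻ e₀)
      ... | yes φ₀<φ₀ | _         = contradiction φ₀<φ₀ (irrefl refl)
      ... | no _      | yes _     = sym (trans (*-congˡ (trans (+-congˡ -0#≈0#) (+-identityʳ 1#))) (*-identityʳ _))
      ... | no _      | no φ₀≤φ⁻  = contradiction
        (0<b-a⇒a<b (<-cong refl (yg≈ e₀) (*-pos (0<y e₀) 0<g))) φ₀≤φ⁻
      source-bound : ∀ v → p v * S v ≤ κ v
      source-bound v with below v
      ... | yes _ = ≤-cong (sym (zeroʳ _)) refl (0≤κ v)
      ... | no  _ = ≤-cong (sym (*-identityʳ _)) refl (p≤κ v)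
      cut : g e₀ ≤ sum κ
      -- The flow through `e₀` is at most the total flow across the cut, which by summation by parts
      -- is the total of `p` over the level set.
      cut K<g = ≤-trans (≤-cong (sym (crossing₀ (≤-<-trans (0≤sum 0≤κ) K<g))) refl
          (term≤sum {f = λ e → g e * (S (∂⁺ e) - S (∂⁻ e))} crossing-≥0 e₀))
        (≤-cong divergence refl (sum-mono-≤ source-bound)) K<g
        where
        divergence : dot p S ≈ sum (λ e → g e * (S (∂⁺ e) - S (∂⁻ e)))
        divergence = begin
          dot p S                                  ≈⟨ dot-cong {v = S} ∂g≋p (λ _ → refl) ⟨
          dot (g ⋆ incidence) S                    ≈⟨ dot-⋆ˡ g incidence S ⟩
          dot g (λ e → dot (incidence e) S)        ≈⟨ dot-cong {u = g} (λ _ → refl) (λ e → incidence-dot e S) ⟩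
          sum (λ e → g e * (S (∂⁺ e) - S (∂⁻ e)))  ∎

  module Cycles (connected : IsConnected) {k} (γ : Vector (Vector ℤ m) k) (basis : IsℤBasis G γ) where
    open IsℤBasis basis

    M : Matrix k m
    M = basisMatrix γ

    root : Fin n
    root = proj₁ connected

    path : Vector (Vector ℤ m) n
    path v = walk (proj₂ connected root v)

    path-matrix : Matrix n m
    path-matrix = basisMatrix path

    -- Since z ↦ Σ zₑ closed-walkₑ is the identity on cycles, the coordinates of
    -- the closed walks in the basis γ form a right inverse T of M.
    closed-walk : Vector (Vector ℤ m) m
    closed-walk e f = unit e f ℤ.+ (path (∂⁻ e) f ℤ.- path (∂⁺ e) f)

    fromℤ-closed-walk : ∀ e f → fromℤ (closed-walk e f) ≈ - 1# * (incidence · path-matrix) e f + 𝟙 e f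
    fromℤ-closed-walk e f = begin
      fromℤ (closed-walk e f)
        ≈⟨ trans (fromℤ-+ (unit e f) _) (+-cong (fromℤ-unit e f)
             (trans (fromℤ-+ (path (∂⁻ e) f) _) (+-congˡ (fromℤ-neg (path (∂⁺ e) f))))) ⟩
      𝟙 e f + (path-matrix (∂⁻ e) f - path-matrix (∂⁺ e) f)
        ≈⟨ solve 3 (λ a b c → c :+ (b :- a) := :- (a :- b) :+ c) refl (path-matrix (∂⁺ e) f) (path-matrix (∂⁻ e) f) (𝟙 e f) ⟩
      - (path-matrix (∂⁺ e) f - path-matrix (∂⁻ e) f) + 𝟙 e f
        ≈⟨ +-congʳ (trans (-1*x≈-x _) (-‿cong (incidence-dot e (λ v → path-matrix v f)))) ⟨
      - 1# * (incidence · path-matrix) e f + 𝟙 e f ∎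

    -- The paths from the root are regrouped by their end vertex, so the deviation from the identity
    -- depends only on the boundary of `z` and vanishes on cycles.
    ⋆-closed-walks : ∀ (z : Vector Carrier m) → z ⋆ basisMatrix closed-walk ≋ᵥ (λ f → - 1# * (∂ G z ⋆ path-matrix) f + z f)
    ⋆-closed-walks z f = begin
      sum (λ e → z e * fromℤ (closed-walk e f))
        ≈⟨ dot-comm z _ ⟩
      sum (λ e → fromℤ (closed-walk e f) * z e)
        ≈⟨ dot-cong {v = z} (λ e → fromℤ-closed-walk e f) (λ _ → refl) ⟩
      dot (λ e → - 1# * (incidence · path-matrix) e f + 𝟙 e f) z
        ≈⟨ dot-linearˡ (- 1#) (λ e → (incidence · path-matrix) e f) (λ e → 𝟙 e f) z ⟩
      - 1# * dot (λ e → (incidence · path-matrix) e f) z + dot (λ e → 𝟙 e f) z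
        ≈⟨ +-cong (*-congˡ (trans (dot-comm _ z) (sym (⋆-assoc z incidence path-matrix f))))
                  (trans (dot-comm _ z) (⋆-𝟙 z f)) ⟩
      - 1# * (∂ G z ⋆ path-matrix) f + z f ∎

    closed-walk∈H₁ : ∀ e → H₁ G (closed-walk e)
    closed-walk∈H₁ e t = begin
      ∂ G (fromℤ ∘ closed-walk e) t
        ≈⟨ ⋆-congˡ incidence (fromℤ-closed-walk e) t ⟩
      ((λ f → - 1# * (incidence · path-matrix) e f + 𝟙 e f) ⋆ incidence) t
        ≈⟨ ⋆-linear (- 1#) ((incidence · path-matrix) e) (𝟙 e) incidence t ⟩
      - 1# * ((incidence e ⋆ path-matrix) ⋆ incidence) t + (𝟙 e ⋆ incidence) t
        ≈⟨ +-cong (trans (-1*x≈-x _) (-‿cong (trans (⋆-assoc (incidence e) path-matrix incidence t)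
             (incidence-dot e (λ v → ∂ G (path-matrix v) t))))) (𝟙-⋆ e incidence t) ⟩
      - (∂ G (path-matrix (∂⁺ e)) t - ∂ G (path-matrix (∂⁻ e)) t) + incidence e t
        ≈⟨ +-congʳ (-‿cong (+-cong (∂-walk (proj₂ connected root (∂⁺ e)) t) (-‿cong (∂-walk (proj₂ connected root (∂⁻ e)) t)))) ⟩
      - (indicator G (∂⁺ e) t - indicator G root t - (indicator G (∂⁻ e) t - indicator G root t)) + incidence e t
        ≈⟨ solve 3 (λ a b r → :- (a :- r :- (b :- r)) :+ (a :- b) := :0) refl (indicator G (∂⁺ e) t) (indicator G (∂⁻ e) t) (indicator G root t) ⟩
      0# ∎

    coeffs : Vector (Vector ℤ k) m
    coeffs e = proj₁ (spanning (closed-walk e) (closed-walk∈H₁ e))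

    T : Matrix m k
    T = basisMatrix coeffs

    sumℤ : ∀ {j} → Vector ℤ j → ℤ
    sumℤ = RawMonoidDefs.sum ℤ.+-0-rawMonoid

    fromℤ-sum : ∀ {j} (f : Vector ℤ j) → fromℤ (sumℤ f) ≈ sum (fromℤ ∘ f)
    fromℤ-sum {zero}  f = refl
    fromℤ-sum {suc j} f = trans (fromℤ-+ (f zero) _) (+-congˡ (fromℤ-sum (f ∘ suc)))

    fromℤ-dot : ∀ {j} (a b : Vector ℤ j) → fromℤ (sumℤ (λ i → a i ℤ.* b i)) ≈ dot (fromℤ ∘ a) (fromℤ ∘ b)
    fromℤ-dot a b = trans (fromℤ-sum (λ i → a i ℤ.* b i)) (sum-cong-≋ λ i → fromℤ-* (a i) (b i))

    T·M : ∀ e f → fromℤ (closed-walk e f) ≈ (T · M) e f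
    T·M e f = trans (reflexive (≡.cong fromℤ (proj₂ (spanning (closed-walk e) (closed-walk∈H₁ e)) f)))
      (fromℤ-dot (coeffs e) (λ i → γ i f))

    -- Integral relations are computed in the reals, where the linearity lemmas live; this carries
    -- them back to the integers for `independent`.
    fromℤ-injective : ∀ z → fromℤ z ≈ 0# → z ≡ 0ℤ
    fromℤ-injective (+ zero)  _  = ≡.refl
    fromℤ-injective (+ suc j) z≈0 = contradiction (0<+suc j) (irrefl (sym z≈0))
      where
      0<+suc : ∀ j → 0# < suc j ⨯ 1#
      0<+suc zero    = <-cong refl (sym (+-identityʳ 1#)) 0<1
      0<+suc (suc j) = 0<+ (<⇒≤ 0<1) (0<+suc j)
    fromℤ-injective -[1+ j ] z≈0 = contradiction
      (≡.trans (≡.sym (ℤ.neg-involutive -[1+ j ]))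
        (≡.cong ℤ.-_ (fromℤ-injective (+ suc j) (trans (sym (-‿involutive _)) (trans (-‿cong z≈0) -0#≈0#)))))
      λ ()

    cycle-coefficients : ∀ j → M j ⋆ (T · M) ≋ᵥ M j
    cycle-coefficients j f = begin
      (M j ⋆ (T · M)) f
        ≈⟨ sum-cong-≋ (λ e → *-congˡ {M j e} (T·M e f)) ⟨
      (M j ⋆ basisMatrix closed-walk) f
        ≈⟨ ⋆-closed-walks (M j) f ⟩
      - 1# * (∂ G (M j) ⋆ path-matrix) f + M j f
        ≈⟨ +-congʳ (trans (*-congˡ (sum-zero λ v → trans (*-congʳ (members j v)) (zeroˡ (path-matrix v f)))) (zeroʳ _)) ⟩
      0# + M j f
        ≈⟨ +-identityˡ _ ⟩
      M j f ∎

    -- `cycle-coefficients` says M T M = M. Hence each row of M T - 1 is an integral relation among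
    -- the basis cycles, and independence makes it zero.
    M·T≋𝟙 : M · T ≋ 𝟙
    M·T≋𝟙 j i = begin
      (M · T) j i             ≈⟨ fromℤ-dot (γ j) (λ e → coeffs e i) ⟨
      fromℤ (b i)             ≡⟨ ≡.cong fromℤ b≡unit ⟩
      fromℤ (unit j i)        ≈⟨ fromℤ-unit j i ⟩
      𝟙 j i                   ∎
      where
      b d : Vector ℤ k
      b i = sumℤ (λ e → γ j e ℤ.* coeffs e i)
      d i = b i ℤ.- unit j i
      fromℤ-d : ∀ i → fromℤ (d i) ≈ - 1# * 𝟙 j i + (M · T) j i
      fromℤ-d i = trans (fromℤ-+ (b i) _) (trans (+-comm _ _) (+-cong
        (trans (fromℤ-neg (unit j i)) (trans (-‿cong (fromℤ-unit j i)) (sym (-1*x≈-x _))))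
        (fromℤ-dot (γ j) (λ e → coeffs e i))))
      relation : ∀ f → fromℤ (ℤ-combination G d γ f) ≈ 0#
      relation f = begin
        fromℤ (ℤ-combination G d γ f)
          ≈⟨ fromℤ-dot d (λ i → γ i f) ⟩
        ((fromℤ ∘ d) ⋆ M) f
          ≈⟨ ⋆-congˡ M fromℤ-d f ⟩
        ((λ i → - 1# * 𝟙 j i + (M · T) j i) ⋆ M) f
          ≈⟨ ⋆-linear (- 1#) (𝟙 j) ((M · T) j) M f ⟩
        - 1# * (𝟙 j ⋆ M) f + (M j ⋆ T ⋆ M) f
          ≈⟨ +-cong (trans (-1*x≈-x _) (-‿cong (𝟙-⋆ j M f)))
               (trans (⋆-assoc (M j) T M f) (cycle-coefficients j f)) ⟩
        - M j f + M j f
          ≈⟨ -‿inverseˡ _ ⟩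
        0# ∎
      b≡unit : b i ≡ unit j i
      b≡unit = ℤ.i-j≡0⇒i≡j (b i) (unit j i)
        (independent d (λ f → fromℤ-injective _ (relation f)) i)

    -- Kirchhoff's voltage law: Y g is orthogonal to the rows of M, hence to every `closed-walk e`,
    -- so summing it along the paths from the root defines a potential. The flow bound is applied to
    -- g and to its negative, with the same κ = ∣p∣.
    orthogonal-flow-bound : (y g : Vector Carrier m) (p : Vector Carrier n) → (∀ e → 0# < y e) →
      (∀ i → form (diag y) g (M i) ≈ 0#) → ∂ G g ≋ᵥ p → ∀ e → ∣ g e ∣ ≤ sum (λ v → ∣ p v ∣)
    orthogonal-flow-bound y g p 0<y orth ∂g≋p e = ∣∣≤
      (potential-flow-bound y g φ p κ 0<y yg≈ ∂g≋p (λ v → 0≤∣∣ (p v)) (λ v → ≤∣∣ (p v)) e)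
      (potential-flow-bound y (-_ ∘ g) (-_ ∘ φ) (-_ ∘ p) κ 0<y
        (λ e → trans (sym (-‿distribʳ-* _ _)) (trans (-‿cong (yg≈ e)) (sym (-‿+-comm _ _))))
        (λ v → trans (⋆-neg v) (-‿cong (∂g≋p v))) (λ v → 0≤∣∣ (p v)) (λ v → -≤∣∣ (p v)) e)
      where
      κ : Vector Carrier n
      κ v = ∣ p v ∣
      q : Vector Carrier m
      q = g ⋆ diag y
      φ : Vector Carrier n
      φ v = dot q (path-matrix v)
      ⋆-neg : ∀ v → ∂ G (-_ ∘ g) v ≈ - ∂ G g v
      ⋆-neg v = begin
        ∂ G (-_ ∘ g) v
          ≈⟨ sum-cong-≋ (λ e → trans (sym (-‿distribˡ-* (g e) (incidence e v))) (sym (-1*x≈-x _))) ⟩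
        sum (λ e → - 1# * (g e * incidence e v))
          ≈⟨ *-distribˡ-sum (- 1#) (λ e → g e * incidence e v) ⟨
        - 1# * ∂ G g v
          ≈⟨ -1*x≈-x _ ⟩
        - ∂ G g v ∎
      yg≈ : ∀ e → y e * g e ≈ φ (∂⁺ e) - φ (∂⁻ e)
      yg≈ e = begin
        y e * g e
          ≈⟨ trans (*-comm _ _) (sym (⋆-diag g y e)) ⟩
        q e
          ≈⟨ solve 2 (λ q d → q := d :+ (:- d :+ q)) refl (q e) _ ⟩
        Δφ + (- Δφ + q e)
          ≈⟨ +-congˡ closed ⟩
        Δφ + 0#
          ≈⟨ +-identityʳ _ ⟩
        Δφ ∎
        where
        Δφ : Carrier
        Δφ = φ (∂⁺ e) - φ (∂⁻ e)
        closed : - Δφ + q e ≈ 0#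
        closed = begin
          - Δφ + q e
            ≈⟨ +-cong (trans (-1*x≈-x _) (-‿cong (incidence-dot e φ))) (dot-𝟙 e q) ⟨
          - 1# * dot (incidence e) φ + dot (𝟙 e) q
            ≈⟨ +-congʳ (*-congˡ (dot-⋆ʳ q (incidence e) path-matrix)) ⟨
          - 1# * dot q ((incidence · path-matrix) e) + dot (𝟙 e) q
            ≈⟨ +-congʳ (*-congˡ (dot-comm q _)) ⟩
          - 1# * dot ((incidence · path-matrix) e) q + dot (𝟙 e) q
            ≈⟨ dot-linearˡ (- 1#) ((incidence · path-matrix) e) (𝟙 e) q ⟨
          dot (λ f → - 1# * (incidence · path-matrix) e f + 𝟙 e f) q
            ≈⟨ dot-cong {v = q} (λ f → trans (sym (fromℤ-closed-walk e f)) (T·M e f)) (λ _ → refl) ⟩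
          dot (T e ⋆ M) q
            ≈⟨ dot-comm _ q ⟩
          dot q (T e ⋆ M)
            ≈⟨ dot-⋆ʳ q (T e) M ⟩
          dot (T e) (λ i → dot q (M i))
            ≈⟨ sum-zero (λ i → trans (*-congˡ (orth i)) (zeroʳ (T e i))) ⟩
          0# ∎

-- Quadratic estimates and orthogonal projection along the cycle space.

module Estimates {ℓ} (R : RealNumbers ℓ) where

  open Reals R
  open OverReals R
  open Determinant R
  open Forms R
  open ≈-Reasoning

  0≤x+x⇒0≤x : ∀ {x} → 0# ≤ x + x → 0# ≤ x
  0≤x+x⇒0≤x {x} 0≤x+x x<0 = irrefl refl (≤-<-trans 0≤x+x
    (<-trans (<-cong refl (+-identityˡ x) (+-monoˡ-< x x<0)) x<0))

  norm² : ∀ {k} → Vector Carrier k → Carrier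
  norm² u = dot u u

  0≤norm² : ∀ {k} (u : Vector Carrier k) → 0# ≤ norm² u
  0≤norm² u = 0≤sum λ e → 0≤² (u e)

  -- Parallelogram law: the two sides differ by the squared norm of u - v.
  norm²-+ : ∀ {k} (u v : Vector Carrier k) →
            norm² (λ e → u e + v e) ≤ (norm² u + norm² u) + (norm² v + norm² v)
  norm²-+ u v = ≤-cong refl
    (trans (∑-distrib-+ (λ e → u e * u e + u e * u e) (λ e → v e * v e + v e * v e))
      (+-cong (∑-distrib-+ (λ e → u e * u e) _) (∑-distrib-+ (λ e → v e * v e) _)))
    (sum-mono-≤ λ e → ≤-from-diff (0≤² (u e - v e))
      (solve 2 (λ a b → (a :* a :+ a :* a) :+ (b :* b :+ b :* b) := (a :+ b) :* (a :+ b) :+ (a :- b) :* (a :- b)) refl (u e) (v e)))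

  -- Twice the difference of the sides is (c - a)(u + v)² + (c + a)(u - v)². This takes the place of
  -- Cauchy-Schwarz.
  2uav≤ : ∀ {a c} u v → - c ≤ a → a ≤ c → u * a * v + u * a * v ≤ c * (u * u) + c * (v * v)
  2uav≤ {a} {c} u v -c≤a a≤c = ≤-from-diff (0≤x+x⇒0≤x (≤-cong refl
    (solve 4 (λ a c u v → (c :- a) :* ((u :+ v) :* (u :+ v)) :+ (a :- :- c) :* ((u :- v) :* (u :- v))
       := (c :* (u :* u) :+ c :* (v :* v) :- (u :* a :* v :+ u :* a :* v))
       :+ (c :* (u :* u) :+ c :* (v :* v) :- (u :* a :* v :+ u :* a :* v))) refl a c u v)
    (0≤+ (0≤* (a≤b⇒0≤b-a a≤c) (0≤² (u + v))) (0≤* (a≤b⇒0≤b-a -c≤a) (0≤² (u - v))))))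
    (solve 2 (λ x y → y := x :+ (y :- x)) refl (u * a * v + u * a * v) (c * (u * u) + c * (v * v)))

  module Perturbation {m} (A : Matrix m m) (C : Carrier) (A-bound : ∀ i j → - C ≤ A i j × A i j ≤ C) where

    κ : Carrier
    κ = sum {m} (λ _ → C)

    form-expand : ∀ u v → form A u v ≈ sum (λ j → sum (λ i → u i * A i j * v j))
    form-expand u v = sum-cong-≋ λ j → *-distribʳ-sum (v j) (λ i → u i * A i j)

    -- The entrywise inequality is summed over all m² entries; each square occurs m times, whence κ
    -- = m C.
    form-bound : ∀ u v → form A u v + form A u v ≤ κ * norm² u + κ * norm² v
    form-bound u v = ≤-cong (sym lhs) rhs
      (sum-mono-≤ λ j → sum-mono-≤ λ i → 2uav≤ (u i) (v j) (proj₁ (A-bound i j)) (proj₂ (A-bound i j)))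
      where
      lhs : form A u v + form A u v ≈ sum (λ j → sum (λ i → u i * A i j * v j + u i * A i j * v j))
      lhs = begin
        form A u v + form A u v
          ≈⟨ +-cong (form-expand u v) (form-expand u v) ⟩
        sum (λ j → sum (λ i → u i * A i j * v j)) + sum (λ j → sum (λ i → u i * A i j * v j))
          ≈⟨ ∑-distrib-+ (λ j → sum (λ i → u i * A i j * v j)) _ ⟨
        sum (λ j → sum (λ i → u i * A i j * v j) + sum (λ i → u i * A i j * v j))
          ≈⟨ sum-cong-≋ (λ j → ∑-distrib-+ (λ i → u i * A i j * v j) (λ i → u i * A i j * v j)) ⟨
        sum (λ j → sum (λ i → u i * A i j * v j + u i * A i j * v j)) ∎
      rhs : sum (λ j → sum (λ i → C * (u i * u i) + C * (v j * v j))) ≈ κ * norm² u + κ * norm² v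
      rhs = begin
        sum (λ j → sum (λ i → C * (u i * u i) + C * (v j * v j)))
          ≈⟨ sum-cong-≋ (λ j → trans (∑-distrib-+ (λ i → C * (u i * u i)) (λ i → C * (v j * v j)))
               (+-cong (sym (*-distribˡ-sum C (λ i → u i * u i))) (sym (*-distribʳ-sum {m} (v j * v j) (λ _ → C))))) ⟩
        sum (λ j → C * norm² u + κ * (v j * v j))
          ≈⟨ ∑-distrib-+ {m} (λ _ → C * norm² u) (λ j → κ * (v j * v j)) ⟩
        sum {m} (λ _ → C * norm² u) + sum (λ j → κ * (v j * v j))
          ≈⟨ +-cong (*-distribʳ-sum {m} (norm² u) (λ _ → C)) (*-distribˡ-sum κ (λ j → v j * v j)) ⟨
        κ * norm² u + κ * norm² v ∎

    -form-bound : ∀ u v → - form A u v + - form A u v ≤ κ * norm² u + κ * norm² v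
    -form-bound u v = ≤-cong
      (+-cong neg neg)
      (+-congʳ (*-congˡ (sum-cong-≋ λ e → solve 1 (λ a → (:- a) :* (:- a) := a :* a) refl (u e))))
      (form-bound (-_ ∘ u) v)
      where
      neg : form A (-_ ∘ u) v ≈ - form A u v
      neg = begin
        form A (-_ ∘ u) v
          ≈⟨ form-expand (-_ ∘ u) v ⟩
        sum (λ j → sum (λ i → - u i * A i j * v j))
          ≈⟨ sum-cong-≋ (λ j → trans (sum-cong-≋ λ i → trans
               (solve 3 (λ u a v → (:- u) :* a :* v := :- (u :* a :* v)) refl (u i) (A i j) (v j))
               (sym (-1*x≈-x (u i * A i j * v j)))) (sym (*-distribˡ-sum (- 1#) (λ i → u i * A i j * v j)))) ⟩
        sum (λ j → - 1# * sum (λ i → u i * A i j * v j))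
          ≈⟨ *-distribˡ-sum (- 1#) (λ j → sum (λ i → u i * A i j * v j)) ⟨
        - 1# * sum (λ j → sum (λ i → u i * A i j * v j))
          ≈⟨ trans (-1*x≈-x _) (-‿cong (sym (form-expand u v))) ⟩
        - form A u v ∎

    module _ (0≤C : 0# ≤ C) where

      0≤κ : 0# ≤ κ
      0≤κ = 0≤sum {m} λ _ → 0≤C

      -- With y ≥ 2κ + 1, the energy identity for δ gives ∣δ∣² ≤ κ ∣g∣².
      form-stability : (y g g′ δ : Vector Carrier m) (Q : Carrier) →
        (∀ e → κ + κ + 1# ≤ y e) → (∀ e → g′ e ≈ g e + δ e) →
        form (diag y) δ δ ≈ - form A g′ δ → norm² g ≤ Q →
        let E = κ * (Q + Q + Q + (κ * Q + κ * Q)) in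
        ∣ form A g′ g ∣ ≤ E + 1#
      form-stability y g g′ δ Q L≤y g′≈ energy ‖g‖≤Q = ∣∣≤
        (bounded (≤-trans (form-bound g′ g) total))
        (bounded (≤-trans (-form-bound g′ g) total))
        where
        E D H Γ : Carrier
        E = κ * (Q + Q + Q + (κ * Q + κ * Q))
        D = norm² δ
        H = norm² g′
        Γ = norm² g
        0≤Q : 0# ≤ Q
        0≤Q = ≤-trans (0≤norm² g) ‖g‖≤Q
        0≤E : 0# ≤ E
        0≤E = 0≤* 0≤κ (0≤+ (0≤+ (0≤+ 0≤Q 0≤Q) 0≤Q) (0≤+ (0≤* 0≤κ 0≤Q) (0≤* 0≤κ 0≤Q)))
        H≤ : H ≤ (Γ + Γ) + (D + D)
        H≤ = ≤-cong (sym (dot-cong g′≈ g′≈)) refl (norm²-+ g δ)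
        weighted : (κ + κ + 1#) * D ≤ form (diag y) δ δ
        weighted = ≤-cong (sym (*-distribˡ-sum _ (λ e → δ e * δ e))) (sym (form-diag y δ δ))
          (sum-mono-≤ λ e → ≤-from-diff (0≤* (a≤b⇒0≤b-a (L≤y e)) (0≤² (δ e)))
            (solve 3 (λ l y d → y :* d := l :* d :+ (y :- l) :* d) refl (κ + κ + 1#) (y e) (δ e * δ e)))
        2LD≤ : (κ + κ + 1#) * D + (κ + κ + 1#) * D ≤ κ * H + κ * D
        2LD≤ = ≤-trans (+-mono-≤ weighted weighted) (≤-cong (sym (+-cong energy energy)) refl (-form-bound g′ δ))
        -- Inserting H ≤ 2Γ + 2D into `2LD≤` gives (4κ + 2) D ≤ 2κΓ + 3κD. The threshold 2κ + 1 thus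
        -- absorbs all terms in D on the right, and a surplus κD is discarded.
        D≤κΓ : 0# ≤ κ * Γ - D
        D≤κΓ = 0≤x+x⇒0≤x (≤-cong refl (begin
          (κ * H + κ * D - ((κ + κ + 1#) * D + (κ + κ + 1#) * D)) + κ * ((Γ + Γ) + (D + D) - H) + κ * D
            ≈⟨ solve 5 (λ k h d g o → (k :* h :+ k :* d :- ((k :+ k :+ o) :* d :+ (k :+ k :+ o) :* d)) :+ k :* ((g :+ g) :+ (d :+ d) :- h) :+ k :* d
                 := (k :* g :- o :* d) :+ (k :* g :- o :* d)) refl κ H D Γ 1# ⟩
          (κ * Γ - 1# * D) + (κ * Γ - 1# * D)
            ≈⟨ +-cong (+-congˡ (-‿cong (*-identityˡ D))) (+-congˡ (-‿cong (*-identityˡ D))) ⟩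
          (κ * Γ - D) + (κ * Γ - D) ∎)
          (0≤+ (0≤+ (a≤b⇒0≤b-a 2LD≤) (0≤* 0≤κ (a≤b⇒0≤b-a H≤))) (0≤* 0≤κ (0≤norm² δ))))
        -- H + Γ ≤ 3Γ + 2D ≤ 3Γ + 2κΓ with Γ ≤ Q, which is the origin of `E`.
        total : κ * H + κ * Γ ≤ E
        total = ≤-from-diff
          (0≤* 0≤κ (0≤+ (0≤+ (a≤b⇒0≤b-a H≤) (0≤+ D≤κΓ D≤κΓ))
            (0≤+ (0≤+ (0≤+ Q-Γ Q-Γ) Q-Γ) (0≤+ (0≤* 0≤κ Q-Γ) (0≤* 0≤κ Q-Γ)))))
          (solve 5 (λ k h d g q → k :* (q :+ q :+ q :+ (k :* q :+ k :* q))
             := k :* h :+ k :* g :+ k :* (((g :+ g) :+ (d :+ d) :- h) :+ ((k :* g :- d) :+ (k :* g :- d))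
                  :+ (((q :- g) :+ (q :- g) :+ (q :- g)) :+ (k :* (q :- g) :+ k :* (q :- g)))))
             refl κ H D Γ Q)
          where
          Q-Γ : 0# ≤ Q - Γ
          Q-Γ = a≤b⇒0≤b-a ‖g‖≤Q
        bounded : ∀ {x} → x + x ≤ E → x ≤ E + 1#
        bounded {x} 2x≤E = ≤-from-diff
          (0≤+ (0≤x+x⇒0≤x (≤-cong refl
            (solve 2 (λ e x → (e :- (x :+ x)) :+ e := (e :- x) :+ (e :- x)) refl E x)
            (0≤+ (a≤b⇒0≤b-a 2x≤E) 0≤E))) (<⇒≤ 0<1))
          (solve 3 (λ e x o → e :+ o := x :+ ((e :- x) :+ o)) refl E x 1#)

  module OrthogonalProjection {k m} (M : Matrix k m) (ω : Vector Carrier m) where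

    residual : Vector Carrier k → Vector Carrier m
    residual x e = (x ⋆ M) e + ω e

    residual-expandˡ : ∀ B x v → form B (residual x) v ≈ dot x (λ i → form B (M i) v) + form B ω v
    residual-expandˡ B x v = trans
      (form-cong B (λ e → +-congʳ (sym (*-identityˡ _))) (λ _ → refl))
      (trans (form-linearˡ B 1# (x ⋆ M) ω v) (+-congʳ (trans (*-identityˡ _) (form-⋆ˡ B x M v))))

    residual-expandʳ : ∀ B u x → form B u (residual x) ≈ dot x (λ i → form B u (M i)) + form B u ω
    residual-expandʳ B u x = trans
      (form-cong B {u = u} (λ _ → refl) (λ e → +-congʳ (sym (*-identityˡ _))))
      (trans (form-linearʳ B 1# u (x ⋆ M) ω) (+-congʳ (trans (*-identityˡ _) (dot-⋆ʳ (u ⋆ B) x M))))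

    Orthogonal : Matrix m m → Vector Carrier k → Set ℓ
    Orthogonal B x = ∀ i → form B (residual x) (M i) ≈ 0#

    solution⇒orthogonal : ∀ B x → x ⋆ (M · B · M ᵀ) ≋ᵥ (λ i → - form B ω (M i)) → Orthogonal B x
    solution⇒orthogonal B x solution i = trans (residual-expandˡ B x (M i))
      (trans (+-congʳ (solution i)) (-‿inverseˡ _))

    -- Any residual differs from ω by a combination of rows of M, which the pairing does not see.
    orthogonal-residual : ∀ B x x′ → Orthogonal B x → form B (residual x) (residual x′) ≈ form B (residual x) ω
    orthogonal-residual B x x′ orth = trans (residual-expandʳ B (residual x) x′)
      (trans (+-congʳ (sum-zero λ i → trans (*-congˡ (orth i)) (zeroʳ (x′ i)))) (+-identityˡ _))

    module _ (y : Vector Carrier m) (A : Matrix m m) (x x′ : Vector Carrier k)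
             (orth : Orthogonal (diag y) x) (orth′ : Orthogonal (diag y ⊕ A) x′) where

      private
        g g′ δ : Vector Carrier m
        g  = residual x
        g′ = residual x′
        δ e = - 1# * g e + g′ e

        diag-orth : form (diag y) g′ g ≈ form (diag y) g ω
        diag-orth = trans (form-diag-comm y g′ g) (orthogonal-residual (diag y) x x′ orth)

      -- In each pairing ω may be exchanged for the other residual. Both terms then contain the
      -- same, possibly large, Y-pairing of g′ with g, which cancels.
      residual-difference : form (diag y ⊕ A) g′ ω - form (diag y) g ω ≈ form A g′ g
      residual-difference = begin
        form (diag y ⊕ A) g′ ω - form (diag y) g ω
          ≈⟨ +-cong (orthogonal-residual (diag y ⊕ A) x′ x orth′) (-‿cong diag-orth) ⟨
        form (diag y ⊕ A) g′ g - form (diag y) g′ g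
          ≈⟨ +-congʳ (form-⊕ (diag y) A g′ g) ⟩
        form (diag y) g′ g + form A g′ g - form (diag y) g′ g
          ≈⟨ solve 2 (λ a b → a :+ b :- a := b) refl (form (diag y) g′ g) (form A g′ g) ⟩
        form A g′ g ∎

      δ-decomposition : ∀ e → g′ e ≈ g e + δ e
      δ-decomposition e = sym (trans (+-congˡ (+-congʳ (-1*x≈-x _)))
        (solve 2 (λ a b → a :+ (:- a :+ b) := b) refl (g e) (g′ e)))

      -- δ lies in the row span of M, so it is orthogonal to g for Y and to g′ for Y + A; the second
      -- relation minus the first is the identity.
      energy-identity : form (diag y) δ δ ≈ - form A g′ δ
      energy-identity = begin
        Yδδ
          ≈⟨ solve 3 (λ a b c → a := c :+ a :+ b :+ (:- c :- b)) refl Yδδ Ag′δ Ygδ ⟩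
        Ygδ + Yδδ + Ag′δ + (- Ygδ - Ag′δ)
          ≈⟨ +-congʳ (+-congʳ Yg′δ) ⟨
        form (diag y) g′ δ + Ag′δ + (- Ygδ - Ag′δ)
          ≈⟨ +-cong (trans (sym (form-⊕ (diag y) A g′ δ)) (orth-δ (diag y ⊕ A) x′ orth′))
                    (+-congʳ (-‿cong (orth-δ (diag y) x orth))) ⟩
        0# + (- 0# - Ag′δ)
          ≈⟨ solve 1 (λ a → :0 :+ (:- :0 :- a) := :- a) refl Ag′δ ⟩
        - Ag′δ ∎
        where
        Yδδ Ygδ Ag′δ : Carrier
        Yδδ  = form (diag y) δ δ
        Ygδ  = form (diag y) g δ
        Ag′δ = form A g′ δ
        orth-δ : ∀ B z → Orthogonal B z → form B (residual z) δ ≈ 0#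
        orth-δ B z orth = begin
          form B (residual z) δ
            ≈⟨ form-linearʳ B (- 1#) (residual z) g g′ ⟩
          - 1# * form B (residual z) g + form B (residual z) g′
            ≈⟨ +-cong (trans (-1*x≈-x _) (-‿cong (orthogonal-residual B z x orth))) (orthogonal-residual B z x′ orth) ⟩
          - form B (residual z) ω + form B (residual z) ω
            ≈⟨ -‿inverseˡ _ ⟩
          0# ∎
        Yg′δ : form (diag y) g′ δ ≈ Ygδ + Yδδ
        Yg′δ = trans (form-cong (diag y) {v = δ} (λ e → trans (δ-decomposition e) (+-congʳ (sym (*-identityˡ _)))) (λ _ → refl))
          (trans (form-linearˡ (diag y) 1# g δ δ) (+-congʳ (*-identityˡ _)))

-- Comparison of the two determinant quotients with explicit constants.

theorem1p1 :
    ∀ {ℓ o} (R : RealNumbers ℓ) →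
    let open RealNumbers R
        open OverReals R
    in
    (n m : ℕ) (G : OrientedGraph n m) →
    let open OrientedGraph G in
    IsConnected →
    (γ : Vector (Vector ℤ m) h) → IsℤBasis G γ →
    (p : Vector Carrier n) → ¬ (∀ v → p v ≈ 0#) → sum p ≈ 0# →
    (ω : Vector Carrier m) → (∀ v → ∂ G ω v ≈ p v) →
    (U : Set ℓ) (𝓣 : Topology U o)
    (y : Fin m → U → Carrier) →
    (∀ e → Continuous 𝓣 (y e)) → (∀ e s → 0# < y e s) →
    (A : U → Matrix m m) →
    (∃ λ C → 0# < C × (∀ s i j → - C ≤ A s i j × A s i j ≤ C)) →
    let M = basisMatrix γ
        N = appendRow M ω
        Y = λ (s : U) → diag (λ e → y e s)
    in
    (∀ s → Invertible (M · (Y s ⊕ A s) · M ᵀ)) →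
    (∀ s → Invertible (N · (Y s ⊕ A s) · N ᵀ)) →
    -- The first two components say that both quotients are defined.
    Σ[ d₁ ∈ (∀ s → det (M · (Y s ⊕ A s) · M ᵀ) # 0#) ]
    Σ[ d₂ ∈ (∀ s → det (M · Y s · M ᵀ) # 0#) ]
      ((λ s → det (N · (Y s ⊕ A s) · N ᵀ) / det (M · (Y s ⊕ A s) · M ᵀ) ⟨ d₁ s ⟩
            - det (N · Y s · N ᵀ) / det (M · Y s · M ᵀ) ⟨ d₂ s ⟩)
        =O[ y ] (λ _ → 1#))
theorem1p1 R n m G connected γ basis p _ _ ω ∂ω≋p U _ y _ 0<y A (C , 0<C , A-bound) invertible _ =
  -- Adding `1#` makes c = E + 1 positive even when E is zero; C′ = 2κ + 1 is the threshold of
  -- `form-stability`.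
  d₁ , d₂ , E + 1# , κ + κ + 1# , 0<+ 0≤E 0<1 , 0<+ (0≤+ 0≤κ 0≤κ) 0<1 , λ s L≤y →
    ≤-trans (bound s L≤y) c≤c*∣1∣
  where
  open Reals R
  open OverReals R
  open Determinant R
  open Forms R
  open Estimates R
  open Flows R G
  open Cycles connected γ basis
  open OrthogonalProjection M ω
  open ≈-Reasoning

  N : Matrix _ m
  N = appendRow M ω

  Y B : U → Matrix m m
  Y s = diag (λ e → y e s)
  B s = Y s ⊕ A s

  0≤C : 0# ≤ C
  0≤C = <⇒≤ 0<C

  -- `K` bounds each coordinate of g_Y, so `Q` = m K² bounds its squared norm; neither depends on s.
  κ K Q E : Carrier
  κ = sum {m} (λ _ → C)
  K = sum (λ v → ∣ p v ∣)
  Q = sum {m} (λ _ → K * K)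
  E = κ * (Q + Q + Q + (κ * Q + κ * Q))

  0≤κ : 0# ≤ κ
  0≤κ = 0≤sum {m} λ _ → 0≤C

  0≤E : 0# ≤ E
  0≤E = 0≤* 0≤κ (0≤+ (0≤+ (0≤+ 0≤Q 0≤Q) 0≤Q) (0≤+ (0≤* 0≤κ 0≤Q) (0≤* 0≤κ 0≤Q)))
    where
    0≤Q : 0# ≤ Q
    0≤Q = 0≤sum {m} λ _ → 0≤² K

  c≤c*∣1∣ : E + 1# ≤ (E + 1#) * ∣ 1# ∣
  c≤c*∣1∣ = ≤-from-diff (0≤* (<⇒≤ (0<+ 0≤E 0<1)) (a≤b⇒0≤b-a (≤∣∣ 1#)))
    (trans (solve 3 (λ c a o → c :* a := c :* o :+ c :* (a :- o)) refl (E + 1#) ∣ 1# ∣ 1#)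
      (+-congʳ (*-identityʳ _)))

  positive : ∀ s → IsPositive (M · Y s · M ᵀ)
  positive s = gram-positive M T M·T≋𝟙 (λ e → y e s) (λ e → 0<y e s)

  d₁ : ∀ s → det (M · B s · M ᵀ) # 0#
  d₁ s = left-inverse⇒det#0 (proj₁ (proj₂ (invertible s)))

  d₂ : ∀ s → det (M · Y s · M ᵀ) # 0#
  d₂ s = positive⇒det#0 (positive s)

  residual-ratio : ∀ B (d : det (M · B · M ᵀ) # 0#) x → Orthogonal B x →
                   det (N · B · N ᵀ) / det (M · B · M ᵀ) ⟨ d ⟩ ≈ form B (residual x) ω
  residual-ratio B d x orth = begin
    det (N · B · N ᵀ) * i                     ≈⟨ *-congʳ (det-appendRow B M ω x orth) ⟩
    det (M · B · M ᵀ) * form B (residual x) ω * i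
      ≈⟨ solve 3 (λ a b c → a :* b :* c := b :* (a :* c)) refl _ _ _ ⟩
    form B (residual x) ω * (det (M · B · M ᵀ) * i)
      ≈⟨ *-congˡ (proj₂ (proj₂ (#0⇒invertible d))) ⟩
    form B (residual x) ω * 1#
      ≈⟨ *-identityʳ _ ⟩
    form B (residual x) ω ∎
    where
    i : Carrier
    i = proj₁ (#0⇒invertible d)

  module _ (s : U) where

    x x′ : Vector Carrier _
    x  = proj₁ (positive⇒solvable (positive s) (λ i → - form (Y s) ω (M i)))
    -- M B Mᵀ need not be positive, so this system is solved with the inverse given by hypothesis
    -- instead of by elimination.
    x′ = (λ i → - form (B s) ω (M i)) ⋆ proj₁ (invertible s)

    orth : Orthogonal (Y s) x
    orth = solution⇒orthogonal (Y s) x (proj₂ (positive⇒solvable (positive s) _))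

    orth′ : Orthogonal (B s) x′
    orth′ = solution⇒orthogonal (B s) x′ λ i → trans
      (⋆-assoc b Z (M · B s · M ᵀ) i)
      (trans (sum-cong-≋ λ j → *-congˡ {b j} (proj₁ (proj₂ (invertible s)) j i)) (⋆-𝟙 b i))
      where
      b : Vector Carrier _
      b i = - form (B s) ω (M i)
      Z = proj₁ (invertible s)

    residual-flow : ∂ G (residual x) ≋ᵥ p
    residual-flow v = begin
      ((λ e → (x ⋆ M) e + ω e) ⋆ incidence) v
        ≈⟨ ⋆-congˡ incidence (λ e → +-congʳ (*-identityˡ _)) v ⟨
      ((λ e → 1# * (x ⋆ M) e + ω e) ⋆ incidence) v
        ≈⟨ ⋆-linear 1# (x ⋆ M) ω incidence v ⟩
      1# * (x ⋆ M ⋆ incidence) v + ∂ G ω v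
        ≈⟨ +-cong (trans (*-identityˡ _) (trans (⋆-assoc x M incidence v)
             (sum-zero λ i → trans (*-congˡ (IsℤBasis.members basis i v)) (zeroʳ (x i))))) (∂ω≋p v) ⟩
      0# + p v
        ≈⟨ +-identityˡ _ ⟩
      p v ∎

    norm²≤Q : norm² (residual x) ≤ Q
    norm²≤Q = sum-mono-≤ λ e → square (orthogonal-flow-bound (λ e → y e s) (residual x) p (λ e → 0<y e s) orth residual-flow e)
      where
      square : ∀ {a b} → ∣ a ∣ ≤ b → a * a ≤ b * b
      square {a} {b} ∣a∣≤b = ≤-from-diff
        (0≤* (a≤b⇒0≤b-a (≤-trans (≤∣∣ a) ∣a∣≤b)) (a≤b⇒0≤b-a (≤-trans (-≤∣∣ a) ∣a∣≤b)))
        (solve 2 (λ a b → b :* b := a :* a :+ (b :- a) :* (b :- :- a)) refl a b)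

    bound : (∀ e → κ + κ + 1# ≤ y e s) →
            ∣ det (N · B s · N ᵀ) / det (M · B s · M ᵀ) ⟨ d₁ s ⟩ - det (N · Y s · N ᵀ) / det (M · Y s · M ᵀ) ⟨ d₂ s ⟩ ∣ ≤ E + 1#
    bound L≤y = ∣∣≤ (≤-cong (sym difference) refl (≤-trans (≤∣∣ _) stable))
                    (≤-cong (-‿cong (sym difference)) refl (≤-trans (-≤∣∣ _) stable))
      where
      stable : ∣ form (A s) (residual x′) (residual x) ∣ ≤ E + 1#
      stable = Perturbation.form-stability (A s) C (A-bound s) 0≤C (λ e → y e s) (residual x) (residual x′) _ Q L≤y
        (δ-decomposition (λ e → y e s) (A s) x x′ orth orth′)
        (energy-identity (λ e → y e s) (A s) x x′ orth orth′) norm²≤Q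
      difference : det (N · B s · N ᵀ) / det (M · B s · M ᵀ) ⟨ d₁ s ⟩ - det (N · Y s · N ᵀ) / det (M · Y s · M ᵀ) ⟨ d₂ s ⟩
                   ≈ form (A s) (residual x′) (residual x)
      difference = trans
        (+-cong (residual-ratio (B s) (d₁ s) x′ orth′) (-‿cong (residual-ratio (Y s) (d₂ s) x orth)))
        (residual-difference (λ e → y e s) (A s) x x′ orth orth′)
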